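{- Let $W=(\mathbf{z}_p)_{p\ge 0}$ be the infinite $S$-walk, with $S=\{\mathbf{i},\mathbf{j},\mathbf{k}\}\subset\mathbb{Z}^3$, produced by the Gerver–Ramsey construction described in the context. Then $W$ has no $189$ collinear points; that is, no straight line in $\mathbb{R}^3$ contains $189$ (or more) of the points of $W$.
   Context: Let $\mathbf{i},\mathbf{j},\mathbf{k}$ be the three standard orthonormal unit vectors of $\mathbb{R}^3$. For $S\subset\mathbb{Z}^3$, an $S$-walk is a (finite or infinite) sequence of vectors $(\mathbf{z}_p)$ with $\mathbf{z}_{p+1}-\mathbf{z}_p\in S$ for all $p$. Gerver–Ramsey construction. Define operators $\alpha,\beta$ on $\{\mathbf{i},\mathbf{j},\mathbf{k}\}$ by $\alpha\mathbf{i}=\mathbf{j}$, $\alpha\mathbf{j}=\mathbf{i}$, $\alpha\mathbf{k}=\mathbf{k}$ and $\beta\mathbf{i}=\mathbf{i}$, $\beta\mathbf{j}=\mathbf{k}$, $\beta\mathbf{k}=\mathbf{j}$. For finite sequences $A=(a_1,\dots,a_n)$ and $B=(b_1,\dots,b_m)$ of these vectors, write $RA=(a_n,\dots,a_1)$, $(A,B)=(a_1,\dots,a_n,b_1,\dots,b_m)$ (concatenation), and, for an operator $\theta$, $\theta A=(\theta a_1,\dots,\theta a_n)$. Let $A_0=(\mathbf{i})$ and $$A_{n+1}=(A_n,\ \alpha A_n,\ R\beta A_n,\ A_n,\ R\beta\alpha A_n,\ R\beta A_n,\ A_n)\qquad(n\ge 0).$$ Each $A_n$ has length $7^n$ and is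 a prefix of $A_{n+1}$, so there is a unique infinite sequence $(\mathbf{v}_p)_{p\ge1}$ with $(\mathbf{v}_1,\dots,\mathbf{v}_{7^n})=A_n$ for all $n$. Put $\mathbf{z}_0=\mathbf{0}$ and $\mathbf{z}_p=\sum_{q=1}^p\mathbf{v}_q$ for $p\ge 1$, and $W=(\mathbf{z}_p)_{p\ge0}$. -}

module Defs where

open import Algebra.Bundles using (CommutativeMonoid)
import Algebra.Properties.CommutativeSemigroup
import Algebra.Properties.Group
import Algebra.Properties.Ring
open import Data.Fin.Base using (Fin; zero; suc; toℕ; fromℕ<)
open import Data.Fin.Properties using (toℕ-fromℕ<; toℕ<n)
open import Data.Integer.Base as ℤ using (ℤ; 0ℤ; 1ℤ)
import Data.Integer.Properties as ℤ
open import Data.Integer.Tactic.RingSolver using (solve-∀)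
open import Data.List.Base
  using (List; []; _∷_; [_]; _++_; map; reverse; length; lookup; applyUpTo)
open import Data.List.Properties
  using (length-++; length-map; length-reverse; ++-assoc; ++-identityʳ)
open import Data.Nat.Base as ℕ using (ℕ; zero; suc; _⊔_)
import Data.Nat.Properties as ℕ
import Data.Nat.Tactic.RingSolver as ℕ-Solver
open import Data.Product.Base using (∃-syntax; _×_; _,_; proj₁; proj₂)
open import Data.Rational.Base as ℚ using (ℚ; 0ℚ; 1ℚ; ½)
import Data.Rational.Properties as ℚ
open import Data.Vec.Base as Vec using (Vec; []; _∷_; zipWith)
open import Data.Vec.Relation.Binary.Pointwise.Inductive using (Pointwise)
open import Relation.Nullary.Negation using (¬_)
open import Relation.Binary.PropositionalEquality
  using (_≡_; refl; sym; trans; cong; cong₂; subst; module ≡-Reasoning)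

data Step : Set where
  𝐢 𝐣 𝐤 : Step

α : Step → Step
α 𝐢 = 𝐣
α 𝐣 = 𝐢
α 𝐤 = 𝐤

β : Step → Step
β 𝐢 = 𝐢
β 𝐣 = 𝐤
β 𝐤 = 𝐣

A : ℕ → List Step
A zero    = [ 𝐢 ]
A (suc n) =
  A n ++
  map α (A n) ++
  reverse (map β (A n)) ++
  A n ++
  reverse (map β (map α (A n))) ++
  reverse (map β (A n)) ++
  A n

length-A : ∀ n → length (A n) ≡ 7 ℕ.^ n
length-A zero    = refl
length-A (suc n) = trans seven (cong (7 ℕ.*_) (length-A n))
  where
  a = A n
  ℓ = length a

  Rβ : ∀ xs → length (reverse (map β xs)) ≡ length xs
  Rβ xs = trans (length-reverse (map β xs)) (length-map β xs)

  ++-length : ∀ (xs : List Step) {ys k l} →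
              length xs ≡ k → length ys ≡ l → length (xs ++ ys) ≡ k ℕ.+ l
  ++-length xs p q = trans (length-++ xs) (cong₂ ℕ._+_ p q)

  lemma : ∀ m → m ℕ.+ (m ℕ.+ (m ℕ.+ (m ℕ.+ (m ℕ.+ (m ℕ.+ m))))) ≡ 7 ℕ.* m
  lemma = ℕ-Solver.solve-∀

  seven : length (A (suc n)) ≡ 7 ℕ.* ℓ
  seven = trans
    (++-length a refl
    (++-length (map α a) (length-map α a)
    (++-length (reverse (map β a)) (Rβ a)
    (++-length a refl
    (++-length (reverse (map β (map α a))) (trans (Rβ (map α a)) (length-map α a))
    (++-length (reverse (map β a)) (Rβ a) refl))))))
    (lemma ℓ)

n<7^n : ∀ n → n ℕ.< 7 ℕ.^ n
n<7^n zero    = ℕ.s≤s ℕ.z≤n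
n<7^n (suc n) = ℕ.≤-trans (ℕ.s≤s (n<7^n n))
  (ℕ.≤-trans (ℕ.+-monoˡ-≤ (7 ℕ.^ n) {1} (ℕ.≤-trans (ℕ.s≤s ℕ.z≤n) (n<7^n n)))
             (ℕ.+-monoʳ-≤ (7 ℕ.^ n) (ℕ.m≤m+n (7 ℕ.^ n) _)))

p<length-A : ∀ p → p ℕ.< length (A p)
p<length-A p = subst (p ℕ.<_) (sym (length-A p)) (n<7^n p)

-- Indexed from 0: v p is 𝐯ₚ₊₁.  Reading it off A p is justified by v-prefix.
v : ℕ → Step
v p = lookup (A p) (fromℕ< (p<length-A p))

private
  A-extends : ∀ n k → ∃[ ys ] A (k ℕ.+ n) ≡ A n ++ ys
  A-extends n zero    = [] , sym (++-identityʳ (A n))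
  A-extends n (suc k) with ys , eq ← A-extends n k =
    _ , trans (cong (_++ rest (A (k ℕ.+ n))) eq) (++-assoc (A n) ys _)
    where
    rest : List Step → List Step
    rest a = map α a ++ reverse (map β a) ++ a ++
             reverse (map β (map α a)) ++ reverse (map β a) ++ a

  lookup-prefix : ∀ xs ys {zs : List Step} → zs ≡ xs ++ ys →
                  (i : Fin (length xs)) (j : Fin (length zs)) →
                  toℕ i ≡ toℕ j → lookup xs i ≡ lookup zs j
  lookup-prefix (x ∷ xs) ys refl zero    zero    _ = refl
  lookup-prefix (x ∷ xs) ys refl (suc i) (suc j) p =
    lookup-prefix xs ys refl i j (ℕ.suc-injective p)

  lookup-A : ∀ m n (i : Fin (length (A m))) (j : Fin (length (A n))) →
             toℕ i ≡ toℕ j → lookup (A m) i ≡ lookup (A n) j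
  lookup-A m n i j p =
    trans (lookup-prefix (A m) _ (proj₂ (A-extends m n)) i i′ (sym (toℕ-fromℕ< _)))
          (sym (lookup-prefix (A n) _ eqₙ j i′ (trans (sym p) (sym (toℕ-fromℕ< _)))))
    where
    eqₙ : A (n ℕ.+ m) ≡ A n ++ proj₁ (A-extends n m)
    eqₙ = trans (cong A (ℕ.+-comm n m)) (proj₂ (A-extends n m))

    i< : toℕ i ℕ.< length (A (n ℕ.+ m))
    i< = subst (toℕ i ℕ.<_)
           (sym (trans (cong length (proj₂ (A-extends m n))) (length-++ (A m))))
           (ℕ.≤-trans (toℕ<n i) (ℕ.m≤m+n _ _))

    i′ : Fin (length (A (n ℕ.+ m)))
    i′ = fromℕ< i<

  applyUpTo-lookup : ∀ (f : ℕ → Step) xs → (∀ i → f (toℕ i) ≡ lookup xs i) →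
                     applyUpTo f (length xs) ≡ xs
  applyUpTo-lookup f []       h = refl
  applyUpTo-lookup f (x ∷ xs) h =
    cong₂ _∷_ (h zero) (applyUpTo-lookup (λ n → f (suc n)) xs (λ i → h (suc i)))

v-prefix : ∀ n → applyUpTo v (7 ℕ.^ n) ≡ A n
v-prefix n = trans (cong (applyUpTo v) (sym (length-A n)))
  (applyUpTo-lookup v (A n) λ i →
    lookup-A (toℕ i) n _ i (toℕ-fromℕ< (p<length-A (toℕ i))))

ℤ³ : Set
ℤ³ = Vec ℤ 3

0ℤ³ : ℤ³
0ℤ³ = Vec.replicate 3 0ℤ

infixl 6 _+³_ _-³_

_+³_ _-³_ : ℤ³ → ℤ³ → ℤ³
_+³_ = zipWith ℤ._+_
_-³_ = zipWith ℤ._-_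

⟦_⟧ : Step → ℤ³
⟦ 𝐢 ⟧ = 1ℤ ∷ 0ℤ ∷ 0ℤ ∷ []
⟦ 𝐣 ⟧ = 0ℤ ∷ 1ℤ ∷ 0ℤ ∷ []
⟦ 𝐤 ⟧ = 0ℤ ∷ 0ℤ ∷ 1ℤ ∷ []

S : ℤ³ → Set
S u = ∃[ s ] u ≡ ⟦ s ⟧

record InfiniteWalk (S : ℤ³ → Set) : Set where
  field
    point : ℕ → ℤ³
    step  : ∀ p → S (point (suc p) -³ point p)

open InfiniteWalk public

z : ℕ → ℤ³
z zero    = 0ℤ³
z (suc p) = z p +³ ⟦ v p ⟧

W : InfiniteWalk S
W .point  = z
W .step p = v p , lemma (z p) ⟦ v p ⟧
  where
  cancel : ∀ x y → (x ℤ.+ y) ℤ.- x ≡ y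
  cancel = solve-∀

  lemma : ∀ {n} (xs ys : Vec ℤ n) →
          zipWith ℤ._-_ (zipWith ℤ._+_ xs ys) xs ≡ ys
  lemma []       []       = refl
  lemma (x ∷ xs) (y ∷ ys) = cong₂ _∷_ (cancel x y) (lemma xs ys)

IsCauchy : (ℕ → ℚ) → Set
IsCauchy x = ∀ ε → 0ℚ ℚ.< ε →
  ∃[ N ] (∀ m n → N ℕ.≤ m → N ℕ.≤ n → ℚ.∣ x m ℚ.- x n ∣ ℚ.< ε)

-- To be compared with _≃_ (difference tends to 0), never with _≡_.
record ℝ : Set where
  constructor mkℝ
  field
    seq    : ℕ → ℚ
    cauchy : IsCauchy seq

open ℝ public

infix 4 _≃_

_≃_ : ℝ → ℝ → Set
x ≃ y = ∀ ε → 0ℚ ℚ.< ε →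
  ∃[ N ] (∀ n → N ℕ.≤ n → ℚ.∣ seq x n ℚ.- seq y n ∣ ℚ.< ε)

fromℚ : ℚ → ℝ
fromℚ q = mkℝ (λ _ → q) λ ε 0<ε →
  0 , λ _ _ _ _ → subst (λ r → ℚ.∣ r ∣ ℚ.< ε) (sym (ℚ.+-inverseʳ q)) 0<ε

fromℤ : ℤ → ℝ
fromℤ a = fromℚ (a ℚ./ 1)

private
  module ℚ+      = Algebra.Properties.Group ℚ.+-0-group
  module ℚ+-comm = Algebra.Properties.CommutativeSemigroup
    (CommutativeMonoid.commutativeSemigroup ℚ.+-0-commutativeMonoid)
  module ℚ-ring  = Algebra.Properties.Ring ℚ.+-*-ring

  split : ∀ a b → a ≡ (a ℚ.- b) ℚ.+ b
  split a b = sym (ℚ+.//-rightDividesˡ b a)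

  split-+ : ∀ a b c d →
    (a ℚ.+ b) ℚ.- (c ℚ.+ d) ≡ (a ℚ.- c) ℚ.+ (b ℚ.- d)
  split-+ a b c d =
    trans (cong ((a ℚ.+ b) ℚ.+_) (ℚ.neg-distrib-+ c d))
          (ℚ+-comm.interchange a b (ℚ.- c) (ℚ.- d))

  split-* : ∀ a b c d →
    (a ℚ.* b) ℚ.- (c ℚ.* d) ≡ (a ℚ.* (b ℚ.- d)) ℚ.+ ((a ℚ.- c) ℚ.* d)
  split-* a b c d = sym (begin
    (a ℚ.* (b ℚ.- d)) ℚ.+ ((a ℚ.- c) ℚ.* d)
      ≡⟨ cong₂ ℚ._+_ (ℚ-ring.x[y-z]≈xy-xz a b d) (ℚ-ring.[y-z]x≈yx-zx d a c) ⟩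
    ((a ℚ.* b) ℚ.- (a ℚ.* d)) ℚ.+ ((a ℚ.* d) ℚ.- (c ℚ.* d))
      ≡⟨ ℚ.+-assoc ((a ℚ.* b) ℚ.- (a ℚ.* d)) (a ℚ.* d) (ℚ.- (c ℚ.* d)) ⟨
    (((a ℚ.* b) ℚ.- (a ℚ.* d)) ℚ.+ (a ℚ.* d)) ℚ.- (c ℚ.* d)
      ≡⟨ cong (ℚ._- (c ℚ.* d)) (split (a ℚ.* b) (a ℚ.* d)) ⟨
    (a ℚ.* b) ℚ.- (c ℚ.* d) ∎)
    where open ≡-Reasoning

  module _ (x y : ℕ → ℚ) where

    +-cauchy : IsCauchy x → IsCauchy y → IsCauchy (λ n → x n ℚ.+ y n)
    +-cauchy cx cy ε 0<ε = Nx ⊔ Ny , bound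
      where
      δ = ½ ℚ.* ε
      0<δ : 0ℚ ℚ.< δ
      0<δ = subst (ℚ._< δ) (ℚ.*-zeroʳ ½) (ℚ.*-monoʳ-<-pos ½ 0<ε)
      δ+δ≡ε : δ ℚ.+ δ ≡ ε
      δ+δ≡ε = trans (sym (ℚ.*-distribʳ-+ ε ½ ½)) (ℚ.*-identityˡ ε)
      Nx = proj₁ (cx δ 0<δ)
      Ny = proj₁ (cy δ 0<δ)
      bound : ∀ m n → Nx ⊔ Ny ℕ.≤ m → Nx ⊔ Ny ℕ.≤ n →
              ℚ.∣ (x m ℚ.+ y m) ℚ.- (x n ℚ.+ y n) ∣ ℚ.< ε
      bound m n m≥ n≥ = begin-strict
        ℚ.∣ (x m ℚ.+ y m) ℚ.- (x n ℚ.+ y n) ∣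
          ≡⟨ cong ℚ.∣_∣ (split-+ (x m) (y m) (x n) (y n)) ⟩
        ℚ.∣ (x m ℚ.- x n) ℚ.+ (y m ℚ.- y n) ∣
          ≤⟨ ℚ.∣p+q∣≤∣p∣+∣q∣ (x m ℚ.- x n) (y m ℚ.- y n) ⟩
        ℚ.∣ x m ℚ.- x n ∣ ℚ.+ ℚ.∣ y m ℚ.- y n ∣
          <⟨ ℚ.+-mono-<
               (proj₂ (cx δ 0<δ) m n (ℕ.m⊔n≤o⇒m≤o Nx Ny m≥) (ℕ.m⊔n≤o⇒m≤o Nx Ny n≥))
               (proj₂ (cy δ 0<δ) m n (ℕ.m⊔n≤o⇒n≤o Nx Ny m≥) (ℕ.m⊔n≤o⇒n≤o Nx Ny n≥)) ⟩
        δ ℚ.+ δ ≡⟨ δ+δ≡ε ⟩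
        ε ∎
        where open ℚ.≤-Reasoning

  0<1 : 0ℚ ℚ.< 1ℚ
  0<1 = ℚ.positive⁻¹ 1ℚ

  cauchy-bounded : ∀ x → IsCauchy x →
    ∃[ K ] 0ℚ ℚ.< K × ∃[ N ] (∀ n → N ℕ.≤ n → ℚ.∣ x n ∣ ℚ.≤ K)
  cauchy-bounded x cx = K , 0<K , N , bound
    where
    N = proj₁ (cx 1ℚ 0<1)
    K = 1ℚ ℚ.+ ℚ.∣ x N ∣
    0<K : 0ℚ ℚ.< K
    0<K = ℚ.+-mono-<-≤ 0<1 (ℚ.0≤∣p∣ (x N))
    bound : ∀ n → N ℕ.≤ n → ℚ.∣ x n ∣ ℚ.≤ K
    bound n n≥ = begin
      ℚ.∣ x n ∣                         ≡⟨ cong ℚ.∣_∣ (split (x n) (x N)) ⟩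
      ℚ.∣ (x n ℚ.- x N) ℚ.+ x N ∣       ≤⟨ ℚ.∣p+q∣≤∣p∣+∣q∣ (x n ℚ.- x N) (x N) ⟩
      ℚ.∣ x n ℚ.- x N ∣ ℚ.+ ℚ.∣ x N ∣   ≤⟨ ℚ.+-monoˡ-≤ ℚ.∣ x N ∣
                                             (ℚ.<⇒≤ (proj₂ (cx 1ℚ 0<1) n N n≥ ℕ.≤-refl)) ⟩
      K                                 ∎
      where open ℚ.≤-Reasoning

  *-cauchy : ∀ x y → IsCauchy x → IsCauchy y → IsCauchy (λ n → x n ℚ.* y n)
  *-cauchy x y cx cy ε 0<ε
    with K , 0<K , M  , x≤K ← cauchy-bounded x cx
       | L , 0<L , M′ , y≤L ← cauchy-bounded y cy
    = N , bound
    where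
    instance
      K>0 = ℚ.positive 0<K
      L>0 = ℚ.positive 0<L
      K≥0 = ℚ.pos⇒nonNeg K
      L≥0 = ℚ.pos⇒nonNeg L
      K+L>0 = ℚ.pos+pos⇒pos K L
      K+L≢0 = ℚ.pos⇒nonZero (K ℚ.+ L)
      1/>0 = ℚ.1/pos⇒pos (K ℚ.+ L)
    δ = (ℚ.1/ (K ℚ.+ L)) ℚ.* ε
    0<δ : 0ℚ ℚ.< δ
    0<δ = subst (ℚ._< δ) (ℚ.*-zeroʳ (ℚ.1/ (K ℚ.+ L)))
            (ℚ.*-monoʳ-<-pos (ℚ.1/ (K ℚ.+ L)) 0<ε)
    sum≡ε : (K ℚ.* δ) ℚ.+ (δ ℚ.* L) ≡ ε
    sum≡ε = begin
      (K ℚ.* δ) ℚ.+ (δ ℚ.* L)   ≡⟨ cong ((K ℚ.* δ) ℚ.+_) (ℚ.*-comm δ L) ⟩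
      (K ℚ.* δ) ℚ.+ (L ℚ.* δ)   ≡⟨ ℚ.*-distribʳ-+ δ K L ⟨
      (K ℚ.+ L) ℚ.* δ           ≡⟨ ℚ.*-assoc (K ℚ.+ L) (ℚ.1/ (K ℚ.+ L)) ε ⟨
      ((K ℚ.+ L) ℚ.* (ℚ.1/ (K ℚ.+ L))) ℚ.* ε
                                ≡⟨ cong (ℚ._* ε) (ℚ.*-inverseʳ (K ℚ.+ L)) ⟩
      1ℚ ℚ.* ε                  ≡⟨ ℚ.*-identityˡ ε ⟩
      ε                         ∎
      where open ≡-Reasoning
    Nx = proj₁ (cx δ 0<δ)
    Ny = proj₁ (cy δ 0<δ)
    N  = (M ⊔ M′) ⊔ (Nx ⊔ Ny)
    bound : ∀ m n → N ℕ.≤ m → N ℕ.≤ n →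
            ℚ.∣ (x m ℚ.* y m) ℚ.- (x n ℚ.* y n) ∣ ℚ.< ε
    bound m n m≥ n≥ = begin-strict
      ℚ.∣ (x m ℚ.* y m) ℚ.- (x n ℚ.* y n) ∣
        ≡⟨ cong ℚ.∣_∣ (split-* (x m) (y m) (x n) (y n)) ⟩
      ℚ.∣ (x m ℚ.* dy) ℚ.+ (dx ℚ.* y n) ∣
        ≤⟨ ℚ.∣p+q∣≤∣p∣+∣q∣ (x m ℚ.* dy) (dx ℚ.* y n) ⟩
      ℚ.∣ x m ℚ.* dy ∣ ℚ.+ ℚ.∣ dx ℚ.* y n ∣
        ≡⟨ cong₂ ℚ._+_ (ℚ.∣p*q∣≡∣p∣*∣q∣ (x m) dy) (ℚ.∣p*q∣≡∣p∣*∣q∣ dx (y n)) ⟩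
      (ℚ.∣ x m ∣ ℚ.* ℚ.∣ dy ∣) ℚ.+ (ℚ.∣ dx ∣ ℚ.* ℚ.∣ y n ∣)
        ≤⟨ ℚ.+-mono-≤
             (ℚ.*-monoʳ-≤-nonNeg ℚ.∣ dy ∣ {{ℚ.nonNegative (ℚ.0≤∣p∣ dy)}}
               (x≤K m (ℕ.m⊔n≤o⇒m≤o M M′ MM′≤m)))
             (ℚ.*-monoˡ-≤-nonNeg ℚ.∣ dx ∣ {{ℚ.nonNegative (ℚ.0≤∣p∣ dx)}}
               (y≤L n (ℕ.m⊔n≤o⇒n≤o M M′ MM′≤n))) ⟩
      (K ℚ.* ℚ.∣ dy ∣) ℚ.+ (ℚ.∣ dx ∣ ℚ.* L)
        <⟨ ℚ.+-mono-<
             (ℚ.*-monoʳ-<-pos K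
               (proj₂ (cy δ 0<δ) m n (ℕ.m⊔n≤o⇒n≤o Nx Ny NN≤m) (ℕ.m⊔n≤o⇒n≤o Nx Ny NN≤n)))
             (ℚ.*-monoˡ-<-pos L
               (proj₂ (cx δ 0<δ) m n (ℕ.m⊔n≤o⇒m≤o Nx Ny NN≤m) (ℕ.m⊔n≤o⇒m≤o Nx Ny NN≤n))) ⟩
      (K ℚ.* δ) ℚ.+ (δ ℚ.* L) ≡⟨ sum≡ε ⟩
      ε ∎
      where
      open ℚ.≤-Reasoning
      dx = x m ℚ.- x n
      dy = y m ℚ.- y n
      MM′≤m = ℕ.m⊔n≤o⇒m≤o (M ⊔ M′) (Nx ⊔ Ny) m≥
      MM′≤n = ℕ.m⊔n≤o⇒m≤o (M ⊔ M′) (Nx ⊔ Ny) n≥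
      NN≤m  = ℕ.m⊔n≤o⇒n≤o (M ⊔ M′) (Nx ⊔ Ny) m≥
      NN≤n  = ℕ.m⊔n≤o⇒n≤o (M ⊔ M′) (Nx ⊔ Ny) n≥

infixl 6 _+ℝ_
infixl 7 _*ℝ_

_+ℝ_ : ℝ → ℝ → ℝ
seq    (x +ℝ y) n = seq x n ℚ.+ seq y n
cauchy (x +ℝ y)   = +-cauchy (seq x) (seq y) (cauchy x) (cauchy y)

_*ℝ_ : ℝ → ℝ → ℝ
seq    (x *ℝ y) n = seq x n ℚ.* seq y n
cauchy (x *ℝ y)   = *-cauchy (seq x) (seq y) (cauchy x) (cauchy y)

ℝ³ : Set
ℝ³ = Vec ℝ 3

infix 4 _≃³_

_≃³_ : ℝ³ → ℝ³ → Set
_≃³_ = Pointwise _≃_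

ι : ℤ³ → ℝ³
ι = Vec.map fromℤ

record Line : Set where
  field
    base        : ℝ³
    direction   : ℝ³
    -- Plain negation, not apartness: classically the same, and
    -- constructively it admits at least as many lines.
    direction≄0 : ¬ (direction ≃³ ι 0ℤ³)

infix 4 _∈ℓ_

_∈ℓ_ : ℝ³ → Line → Set
P ∈ℓ L = ∃[ t ] P ≃³ zipWith _+ℝ_ base (Vec.map (t *ℝ_) direction)
  where open Line L

-- Project the walk along (1,1,1), replacing the coordinate x of a displacement over g steps by
-- 3 x - g.  In the projection Aₙ spans a distance of order 4ⁿ, against its length 7ⁿ, so a gauge φ
-- of a displacement over g steps is of order g^(log 4 / log 7), and φ / g decreases with g.  If 189
-- points are collinear, the displacements between them have equal φ / g, while some two of the points
-- are at most 1/188 as many steps apart as the first and the last.  So it suffices to bound the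
-- slope φ / g above and below by decreasing functions of g, sharply enough that a factor of 188
-- in g separates them.  Both bounds are invariant under (φ , g) ↦ (4 φ , 7 g), and by
-- self-similarity they reduce to finitely many pairs of blocks that are neither equal nor adjacent.
-- For these pairs they are verified by evaluating a search that bounds every block by the
-- hexagonal hull of its projection and subdivides pairs for which this is too coarse.
module Submission where

open import Defs
open import Data.Bool.Base using (Bool; true; false; _∧_; _∨_; T)
open import Data.Bool.Properties using (T-∧; T-∨; T-≡)
open import Data.Empty using (⊥)
open import Data.Fin.Base using (Fin; zero; suc; toℕ; fromℕ<; opposite; inject₁)
open import Data.Fin.Patterns
open import Data.Fin.Properties as Fin
  using (toℕ<n; toℕ-injective; toℕ-inject₁; toℕ≤pred[n])
open import Data.Integer.Base as ℤ using (ℤ)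
import Data.Integer.Properties as ℤ
import Data.Integer.Tactic.RingSolver as ℤ-Solver
open import Data.List.Base
  using (List; []; _∷_; [_]; _++_; map; reverse; concat; length; take; applyUpTo; allFin)
open import Data.List.Membership.Propositional using (_∈_)
open import Data.List.Membership.Propositional.Properties using (∈-allFin)
open import Data.List.Properties
  using (map-id; map-cong; map-∘; concat-map; concat-++; ++-identityʳ; unfold-reverse; reverse-++;
         reverse-involutive; reverse-map; length-map; length-reverse; applyUpTo-∷ʳ)
open import Data.List.Relation.Unary.All as All using (All)
open import Data.List.Relation.Unary.Any using (here; there)
open import Data.Nat.Base as ℕ
open import Data.Nat.Coprimality as Coprime using (1-coprimeTo)
open import Data.Nat.DivMod using (m<n*o⇒m/o<n; m/n*n≤m; m≡m%n+[m/n]*n; m%n<n)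
open import Data.Nat.Properties as ℕ
open import Data.List.Extrema ≤-totalOrder using (argmin; argmax; f[argmin]≤f[xs]; f[xs]≤f[argmax])
open import Data.Nat.Tactic.RingSolver using (solve-∀)
open import Data.Product.Base using (Σ-syntax; ∃-syntax; ∃₂; _×_; _,_; proj₁; proj₂)
open import Data.Rational.Base as ℚ using (ℚ; mkℚ; 0ℚ; 1ℚ; ½)
import Data.Rational.Properties as ℚ
open import Algebra.Properties.Group ℚ.+-0-group using (⁻¹-involutive)
open import Data.Rational.Solver using (module +-*-Solver)
open import Data.Sum.Base using (_⊎_; inj₁; inj₂; [_,_]′)
open import Data.Vec.Base as Vec using (Vec; []; _∷_; lookup)
open import Data.Vec.Properties using (lookup-map; lookup-zipWith)
import Data.Vec.Relation.Binary.Pointwise.Inductive as Pointwise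
open import Function.Base using (_∘_; id)
open import Function.Bundles using (Equivalence)
open import Function.Definitions using (Injective)
open import Relation.Binary.Definitions using (Tri; tri<; tri≈; tri>)
open import Relation.Binary.PropositionalEquality
  using (_≡_; refl; sym; trans; cong; cong₂; subst; subst₂; module ≡-Reasoning)
open import Relation.Nullary.Decidable.Core using (Dec; yes; no)
open import Relation.Nullary.Decidable using (from-yes; _×-dec_; _⊎-dec_)
open import Relation.Nullary.Negation using (¬_; contradiction)

-- The obstacle is pairs of positions in touching blocks: in units of the block their gap has no
-- positive lower bound, so hulls alone give no control of the slope. The recursion removes this
-- case. The blocks of lower level that meet at a junction form the same pair of types again, so
-- subdivision always leads to two blocks with at least one block between them. There the gap is
-- known up to a bounded factor: it lies between κ and κ + 2 blocks, with κ ≥ 1. Single steps are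
-- covered too, since a step can be magnified to a block of level 1 without changing what is
-- asserted about the slope. Slopes of collinear displacements agree because the coordinates of a
-- displacement sum to its number of steps. That number is a parameter along the line, increasing
-- with time, so only positive multiples are compared and the asymmetry of the gauge under sign is
-- harmless. The factor 188 is one less than the number of points, by the pigeonhole principle.

-- Blocks and their subdivision

data Perm : Set where
  1ₚ αₚ βₚ αβₚ βαₚ αβαₚ : Perm

act act⁻¹ : Perm → Step → Step
act 1ₚ   s = s
act αₚ   s = α s
act βₚ   s = β s
act αβₚ  s = α (β s)
act βαₚ  s = β (α s)
act αβαₚ s = α (β (α s))
act⁻¹ αβₚ s = act βαₚ s
act⁻¹ βαₚ s = act αβₚ s
act⁻¹ θ   s = act θ s

infixl 8 _·α _·β

_·α _·β : Perm → Perm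
1ₚ   ·α = αₚ
αₚ   ·α = 1ₚ
βₚ   ·α = βαₚ
αβₚ  ·α = αβαₚ
βαₚ  ·α = βₚ
αβαₚ ·α = αβₚ
1ₚ   ·β = βₚ
αₚ   ·β = αβₚ
βₚ   ·β = 1ₚ
αβₚ  ·β = αₚ
βαₚ  ·β = αβαₚ
αβαₚ ·β = βαₚ

·α-involutive : ∀ θ → θ ·α ·α ≡ θ
·α-involutive 1ₚ   = refl
·α-involutive αₚ   = refl
·α-involutive βₚ   = refl
·α-involutive αβₚ  = refl
·α-involutive βαₚ  = refl
·α-involutive αβαₚ = refl

·β-involutive : ∀ θ → θ ·β ·β ≡ θ
·β-involutive 1ₚ   = refl
·β-involutive αₚ   = refl
·β-involutive βₚ   = refl
·β-involutive αβₚ  = refl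
·β-involutive βαₚ  = refl
·β-involutive αβαₚ = refl

-- (θ , r) stands for the word θ Aₙ, reversed when r is true.
Block : Set
Block = Perm × Bool

children : Block → Vec Block 7
children (θ , false) =
  (θ , false) ∷ (θ ·α , false) ∷ (θ ·β , true) ∷ (θ , false) ∷
  (θ ·β ·α , true) ∷ (θ ·β , true) ∷ (θ , false) ∷ []
children (θ , true) =
  (θ , true) ∷ (θ ·β , false) ∷ (θ ·β ·α , false) ∷ (θ , true) ∷
  (θ ·β , false) ∷ (θ ·α , true) ∷ (θ , true) ∷ []

child : Block → Fin 7 → Block
child t = lookup (children t)

match : Step → Step → ℕ
match 𝐢 𝐢 = 1
match 𝐣 𝐣 = 1
match 𝐤 𝐤 = 1
match _ _ = 0

-- Indicator of the direction of a block: in the projection a block of level n has the net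
-- displacement of the single step `act θ 𝐢`, magnified by 4ⁿ. Reversal does not affect it.
-- `occ-word` proves this.
axis : Block → Step → ℕ
axis (θ , _) = match (act θ 𝐢)

count : ∀ {m} → Vec Block m → Fin m → Step → ℕ
count (t ∷ ts) zero    c = 0
count (t ∷ ts) (suc i) c = axis t c + count ts i c

-- A position of a level n block, g steps from its start, satisfies
-- -lo · 4ⁿ ≤ 4 (3 x - g) ≤ hi · 4ⁿ, where x counts the steps equal to c.
lo₁ hi₁ : Bool → Step → ℕ
lo₁ _     𝐢 = 0
lo₁ false 𝐣 = 4
lo₁ true  𝐣 = 5
lo₁ _     𝐤 = 4
hi₁ _     𝐢 = 8
hi₁ false 𝐣 = 1
hi₁ true  𝐣 = 0
hi₁ _     𝐤 = 0

lo hi : Block → Step → ℕ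
lo (θ , r) c = lo₁ r (act⁻¹ θ c)
hi (θ , r) c = hi₁ r (act⁻¹ θ c)

-- The table of slope bounds and the test of one pair of blocks

record Knot : Set where
  constructor knot
  field from to lower upper : ℕ

open Knot public

-- Only right ends are stored; each interval starts where the previous one ends, so the knots leave
-- no gap, as `cover` requires.
record Cut : Set where
  constructor cut
  field to′ lower′ upper′ : ℕ

knotsFrom : ℕ → List Cut → List Knot
knotsFrom s []               = []
knotsFrom s (cut e l u ∷ cs) = knot s e l u ∷ knotsFrom e cs

-- A knot asserts that φ / g lies between lower / 100 and upper / 100 times (4/7)ᵃ when g / 7ᵃ lies
-- between from / 100 and to / 100.  The cuts are 7^(j/16), rounded; the bounds come from a numerical
-- search for a decreasing function, scaling as above, between the extremal slopes.
cuts : List Cut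
cuts =
  cut 113 167 750 ∷ cut 128 161 723 ∷ cut 144 156 696 ∷ cut 163 150 675 ∷
  cut 184 145 653 ∷ cut 207 140 632 ∷ cut 234 135 605 ∷ cut 265 130 589 ∷
  cut 299 126 568 ∷ cut 337 122 546 ∷ cut 381 118 530 ∷ cut 430 113 511 ∷
  cut 486 110 493 ∷ cut 549 106 477 ∷ cut 620 102 459 ∷ cut 700 99 444 ∷ []

knots : List Knot
knots = knotsFrom 100 cuts

-- A knot passes if its interval misses the range of possible gaps, κ to 2 + κ blocks. Otherwise the
-- least gauge is compared at the largest gap (`b`) and the greatest gauge at the smallest gap
-- (`c`).
okKnots : (x y p l h b c : ℕ) → List Knot → Bool
okKnots x y p l h b c []                  = true
okKnots x y p l h b c (knot s e σ τ ∷ ks) =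
  ((e * p ≤ᵇ x) ∨ ((y ≤ᵇ s * p) ∨ ((σ * b ≤ᵇ l) ∧ (h ≤ᵇ τ * c)))) ∧
  okKnots x y p l h b c ks

-- Runs through the scales p = 7ˢ, q = 4ˢ. As the knots lie between 100 and 700, a scale is void
-- once `2 + κ ≤ p`, as are all later ones, and also while `7 * p ≤ κ`. The factor 25 is 100 / 4,
-- because `l` and `h` bound four times the gauge. The fuel 5 given by `passes` suffices: a search
-- of depth 3 reaches κ at most 4800, and 4802 ≤ 7⁵.
okScales : List Knot → (κ l h : ℕ) → (n p q : ℕ) → Bool
okScales ks κ l h zero    p q = 2 + κ ≤ᵇ p
okScales ks κ l h (suc n) p q =
  (2 + κ ≤ᵇ p) ∨
  (((7 * p ≤ᵇ κ) ∨
    okKnots (100 * κ) (100 * (2 + κ)) p (25 * p * l) (25 * p * h) (q * (2 + κ)) (q * κ) ks) ∧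
   okScales ks κ l h n (7 * p) (4 * q))

-- A record instead of a function, so that evaluation shares the three numbers rather than
-- recomputing nested functions at every use.
record Triple : Set where
  constructor triple
  field at𝐢 at𝐣 at𝐤 : ℕ

infixl 9 _!_

_!_ : Triple → Step → ℕ
triple x y z ! 𝐢 = x
triple x y z ! 𝐣 = y
triple x y z ! 𝐤 = z

tabulate : (Step → ℕ) → Triple
tabulate f = triple (f 𝐢) (f 𝐣) (f 𝐤)

-- `_⊔′_` decides by the built-in comparison, where `_⊔_` would recurse in unary.
max : (Step → ℕ) → ℕ
max f = f 𝐢 ⊔′ (f 𝐣 ⊔′ f 𝐤)

-- Extreme values of the gauge of one coordinate that is known to lie between a - b - y and a - b +
-- x. Truncated subtraction supplies the positive parts.
least most : (a b x y : ℕ) → ℕ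
least a b x y = 3 * (a ∸ (b + y)) ⊔′ 4 * (b ∸ (a + x))
most  a b x y = 3 * ((a + x) ∸ b) ⊔′ 4 * ((b + y) ∸ a)

-- Opaque, like depth below, so that conversion does not unfold the search.
opaque
  passes : (κ l h : ℕ) → Bool
  passes κ l h = okScales knots κ l h 5 1 1

-- Two blocks t and u of a common level n, with κ blocks strictly between them; in the projection
-- the start of u lies 4ⁿ (p - m) from that of t.
test : Block → Block → (p m : Triple) → ℕ → Bool
test t u p m κ = passes κ
  (max λ c → least (4 * (p ! c)) (4 * (m ! c)) (hi u c + lo t c) (lo u c + hi t c))
  (max λ c → most  (4 * (p ! c)) (4 * (m ! c)) (hi u c + lo t c) (lo u c + hi t c))

-- The search

every : ∀ {n} → (Fin n → Bool) → Bool
every {zero}  f = true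
every {suc n} f = f zero ∧ every (f ∘ suc)

everyStep : (Step → Bool) → Bool
everyStep f = f 𝐢 ∧ (f 𝐣 ∧ f 𝐤)

everyPerm : (Perm → Bool) → Bool
everyPerm f = f 1ₚ ∧ (f αₚ ∧ (f βₚ ∧ (f αβₚ ∧ (f βαₚ ∧ f αβαₚ))))

everyBlock : (Block → Bool) → Bool
everyBlock f = everyPerm (λ θ → f (θ , false)) ∧ everyPerm (λ θ → f (θ , true))

-- Siblings after child `i` plus siblings before child `j`: the number of blocks strictly between
-- the two when their parents are consecutive. Each block between the parents adds 7, and for equal
-- parents 7 is subtracted.
sep : Fin 7 → Fin 7 → ℕ
sep i j = toℕ (opposite i) + toℕ j

-- In units of 4ⁿ, child `j` of `u` starts `3 * count (children u) j c` minus `j` from the start of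
-- `u`, and likewise for child `i` of `t`. Negative terms are moved to the other sum.
plus minus : Block → (Step → ℕ) → Fin 7 → Fin 7 → Step → ℕ
plus  u p i j c = 4 * p c + (3 * count (children u) j c + toℕ i)
minus t m i j c = 4 * m c + (3 * count (children t) i c + toℕ j)

check : ℕ → Block → Block → (p m : Triple) → ℕ → Bool
checkChild : ℕ → Block → Block → (p m : Step → ℕ) → ℕ → Fin 7 → Fin 7 → Bool
check zero    t u p m κ = test t u p m κ
check (suc n) t u p m κ = test t u p m κ ∨
  every λ i → every λ j → checkChild n t u (p !_) (m !_) (7 * κ + sep i j) i j
checkChild n t u p m κ i j =
  check n (child t i) (child u j) (tabulate (plus u p i j)) (tabulate (minus t m i j)) κ

opaque
  depth : ℕ
  depth = 3

-- `sep i j ≤ᵇ 7` exempts children that coincide, are adjacent or come in the wrong order.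
checkSameAt : Block → Fin 7 → Fin 7 → Bool
checkSameAt t i j =
  (sep i j ≤ᵇ 7) ∨ checkChild depth t t (λ _ → 0) (λ _ → 0) (sep i j ∸ 7) i j

-- `sep i j` vanishes only for the last child of `t` and the first of `u`. The offsets
-- `3 * axis t c` and 1 express that `u` starts where `t` ends.
checkNextAt : Block → Block → Fin 7 → Fin 7 → Bool
checkNextAt t u i j =
  (sep i j ≤ᵇ 0) ∨ checkChild depth t u (λ c → 3 * axis t c) (λ _ → 1) (sep i j) i j

checkNext : Block → Block → Bool
checkNext t u = every λ i → every (checkNextAt t u i)

-- Blocks t and u that may be consecutive.  The last child of t is t and the first child of u is u,
-- so the blocks of lower level that meet at their junction form the same pair.
infix 4 _⋯_

data _⋯_ : Block → Block → Set where
  ⋯₁ : ∀ {θ} → (θ , false) ⋯ (θ ·α , false)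
  ⋯₂ : ∀ {θ} → (θ , false) ⋯ (θ ·α ·β , true)
  ⋯₃ : ∀ {θ} → (θ , false) ⋯ (θ ·β ·α , true)
  ⋯₄ : ∀ {θ} → (θ , true)  ⋯ (θ ·α , true)
  ⋯₅ : ∀ {θ} → (θ , true)  ⋯ (θ ·β , false)

-- The induction step for the hexagonal hulls: the hull of a child, translated to where that child
-- starts, lies in four times the hull of `t`.
checkHullAt : Block → Fin 7 → Step → Bool
checkHullAt t i c =
  (12 * count (children t) i c + hi (child t i) c ≤ᵇ 4 * toℕ i + 4 * hi t c) ∧
  (4 * toℕ i + lo (child t i) c ≤ᵇ 12 * count (children t) i c + 4 * lo t c)

-- Soundness of the Boolean checks and their evaluation

∨-elim : ∀ {a b} → T (a ∨ b) → T a ⊎ T b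
∨-elim = Equivalence.to T-∨

∧-elim : ∀ {a b} → T (a ∧ b) → T a × T b
∧-elim = Equivalence.to T-∧

every-sound : ∀ {n} (f : Fin n → Bool) → T (every f) → ∀ i → T (f i)
every-sound f h zero    = proj₁ (∧-elim h)
every-sound f h (suc i) = every-sound (f ∘ suc) (proj₂ (∧-elim {f zero} h)) i

everyStep-sound : ∀ f → T (everyStep f) → ∀ c → T (f c)
everyStep-sound f h 𝐢 = proj₁ (∧-elim h)
everyStep-sound f h 𝐣 = proj₁ (∧-elim (proj₂ (∧-elim {f 𝐢} h)))
everyStep-sound f h 𝐤 = proj₂ (∧-elim {f 𝐣} (proj₂ (∧-elim {f 𝐢} h)))

everyPerm-sound : ∀ f → everyPerm f ≡ true → ∀ θ → T (f θ)
everyPerm-sound f h with ∧-elim {f 1ₚ} (Equivalence.from T-≡ h)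
... | p₁ , h₁ with ∧-elim {f αₚ} h₁
... | p₂ , h₂ with ∧-elim {f βₚ} h₂
... | p₃ , h₃ with ∧-elim {f αβₚ} h₃
... | p₄ , h₄ with ∧-elim {f βαₚ} h₄
... | p₅ , p₆ = λ { 1ₚ → p₁ ; αₚ → p₂ ; βₚ → p₃ ; αβₚ → p₄ ; βαₚ → p₅ ; αβαₚ → p₆ }

everyBlock-sound : ∀ f → everyBlock f ≡ true → ∀ t → T (f t)
everyBlock-sound f h (θ , r)
  with ∧-elim {everyPerm (λ θ → f (θ , false))} (Equivalence.from T-≡ h)
everyBlock-sound f h (θ , false) | p , q = everyPerm-sound (λ θ → f (θ , false)) (Equivalence.to T-≡ p) θ
everyBlock-sound f h (θ , true)  | p , q = everyPerm-sound (λ θ → f (θ , true)) (Equivalence.to T-≡ q) θ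

opaque
  unfolding passes depth

  -- The search is evaluated when `refl` is checked here and in `next-checked`, with `passes` and
  -- `depth` unfolded.
  same-checked : ∀ t i j → T (checkSameAt t i j)
  same-checked t i j = every-sound (checkSameAt t i)
    (every-sound (λ i → every (checkSameAt t i))
      (everyBlock-sound (λ t → every λ i → every (checkSameAt t i)) refl t) i) j

  next-checked : ∀ {t u} → t ⋯ u → ∀ i j → T (checkNextAt t u i j)
  next-checked {t} {u} t⋯u i j =
    every-sound (checkNextAt t u i) (every-sound (λ i → every (checkNextAt t u i)) (checked t⋯u) i) j
    where
    checked : ∀ {t u} → t ⋯ u → T (checkNext t u)
    checked (⋯₁ {θ}) = everyPerm-sound (λ θ → checkNext (θ , false) (θ ·α , false)) refl θ
    checked (⋯₂ {θ}) = everyPerm-sound (λ θ → checkNext (θ , false) (θ ·α ·β , true)) refl θ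
    checked (⋯₃ {θ}) = everyPerm-sound (λ θ → checkNext (θ , false) (θ ·β ·α , true)) refl θ
    checked (⋯₄ {θ}) = everyPerm-sound (λ θ → checkNext (θ , true) (θ ·α , true)) refl θ
    checked (⋯₅ {θ}) = everyPerm-sound (λ θ → checkNext (θ , true) (θ ·β , false)) refl θ

hull-checked : ∀ t i c → T (checkHullAt t i c)
hull-checked t i c = everyStep-sound (checkHullAt t i)
  (every-sound (λ i → everyStep (checkHullAt t i))
    (everyBlock-sound (λ t → every λ i → everyStep (checkHullAt t i)) refl t) i) c

-- The gauge and the certified slope bounds

⊔′-mono-≤ : ∀ {a b c d} → a ≤ b → c ≤ d → a ⊔′ c ≤ b ⊔′ d
⊔′-mono-≤ {a} {b} {c} {d} p q = subst₂ _≤_ (⊔≡⊔′ a c) (⊔≡⊔′ b d) (⊔-mono-≤ p q)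

*-distribˡ-⊔′ : ∀ k a b → k * (a ⊔′ b) ≡ k * a ⊔′ k * b
*-distribˡ-⊔′ k a b = trans (cong (k *_) (sym (⊔≡⊔′ a b)))
  (trans (*-distribˡ-⊔ k a b) (⊔≡⊔′ (k * a) (k * b)))

max-mono-≤ : ∀ {f g : Step → ℕ} → (∀ c → f c ≤ g c) → max f ≤ max g
max-mono-≤ p = ⊔′-mono-≤ (p 𝐢) (⊔′-mono-≤ (p 𝐣) (p 𝐤))

*-distribˡ-max : ∀ k f → k * max f ≡ max (λ c → k * f c)
*-distribˡ-max k f = trans (*-distribˡ-⊔′ k (f 𝐢) _)
  (cong (k * f 𝐢 ⊔′_) (*-distribˡ-⊔′ k (f 𝐣) (f 𝐤)))

max-cong : ∀ {f g : Step → ℕ} → (∀ c → f c ≡ g c) → max f ≡ max g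
max-cong p = cong₂ _⊔′_ (p 𝐢) (cong₂ _⊔′_ (p 𝐣) (p 𝐤))

-- The projection has threefold, not sixfold, symmetry: it extends further in the positive
-- coordinate directions than in the negative ones, and 3 : 4 is close to the best compensation.
dev : ℕ → ℕ → ℕ
dev u v = 3 * (u ∸ v) ⊔′ 4 * (v ∸ u)

φ : (u v : Step → ℕ) → ℕ
φ u v = max λ c → dev (u c) (v c)

∸-≤-∸ : ∀ {p q r s} → p + r ≤ q + s → p ∸ q ≤ s ∸ r
∸-≤-∸ {p} {q} {r} {s} h = begin
  p ∸ q               ≡⟨ [m+n]∸[m+o]≡n∸o r p q ⟨
  (r + p) ∸ (r + q)   ≡⟨ cong₂ _∸_ (+-comm r p) (+-comm r q) ⟩
  (p + r) ∸ (q + r)   ≤⟨ ∸-monoˡ-≤ (q + r) h ⟩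
  (q + s) ∸ (q + r)   ≡⟨ [m+n]∸[m+o]≡n∸o q s r ⟩
  s ∸ r               ∎
  where open ≤-Reasoning

*-∸-≤ : ∀ n k l {a b c d} → k * a + l * d ≤ k * b + l * c →
        k * (n * (a ∸ b)) ≤ l * (n * (c ∸ d))
*-∸-≤ n k l {a} {b} {c} {d} h = begin
  k * (n * (a ∸ b))       ≡⟨ swap k n (a ∸ b) ⟩
  n * (k * (a ∸ b))       ≡⟨ cong (n *_) (*-distribˡ-∸ k a b) ⟩
  n * (k * a ∸ k * b)     ≤⟨ *-monoʳ-≤ n (∸-≤-∸ {k * a} {k * b} h) ⟩
  n * (l * c ∸ l * d)     ≡⟨ cong (n *_) (*-distribˡ-∸ l c d) ⟨
  n * (l * (c ∸ d))       ≡⟨ swap n l (c ∸ d) ⟩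
  l * (n * (c ∸ d))       ∎
  where
  open ≤-Reasoning
  swap : ∀ x y z → x * (y * z) ≡ y * (x * z)
  swap = solve-∀

module _ (k : ℕ) {u v a b x y : ℕ}
         (p : 4 * u + k * b ≤ 4 * v + k * (a + x))
         (q : 4 * v + k * a ≤ 4 * u + k * (b + y)) where
  open ≤-Reasoning

  least≤dev : k * least a b x y ≤ 4 * dev u v
  least≤dev = begin
    k * least a b x y
      ≡⟨ *-distribˡ-⊔′ k (3 * (a ∸ (b + y))) (4 * (b ∸ (a + x))) ⟩
    k * (3 * (a ∸ (b + y))) ⊔′ k * (4 * (b ∸ (a + x)))
      ≤⟨ ⊔′-mono-≤
           (*-∸-≤ 3 k 4 {a} {b + y} {u} {v} (subst₂ _≤_ (+-comm (4 * v) _) (+-comm (4 * u) _) q))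
           (*-∸-≤ 4 k 4 {b} {a + x} {v} {u} (subst₂ _≤_ (+-comm (4 * u) _) (+-comm (4 * v) _) p)) ⟩
    4 * (3 * (u ∸ v)) ⊔′ 4 * (4 * (v ∸ u))
      ≡⟨ *-distribˡ-⊔′ 4 (3 * (u ∸ v)) (4 * (v ∸ u)) ⟨
    4 * dev u v ∎

  dev≤most : 4 * dev u v ≤ k * most a b x y
  dev≤most = begin
    4 * dev u v
      ≡⟨ *-distribˡ-⊔′ 4 (3 * (u ∸ v)) (4 * (v ∸ u)) ⟩
    4 * (3 * (u ∸ v)) ⊔′ 4 * (4 * (v ∸ u))
      ≤⟨ ⊔′-mono-≤ (*-∸-≤ 3 4 k {u} {v} {a + x} {b} p) (*-∸-≤ 4 4 k {v} {u} {b + y} {a} q) ⟩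
    k * (3 * ((a + x) ∸ b)) ⊔′ k * (4 * ((b + y) ∸ a))
      ≡⟨ *-distribˡ-⊔′ k (3 * ((a + x) ∸ b)) (4 * ((b + y) ∸ a)) ⟨
    k * most a b x y ∎

Bounded : List Knot → ℕ → ℕ → Set
Bounded ks f g = ∀ a {k} → k ∈ ks → from k * 7 ^ a ≤ 100 * g → 100 * g < to k * 7 ^ a →
  lower k * (4 ^ a * g) ≤ 100 * (7 ^ a * f) × 100 * (7 ^ a * f) ≤ upper k * (4 ^ a * g)

-- The knots stay within one period, from 1 to 7; this is what allows `okScales` to skip scales.
InRange : List Knot → Set
InRange ks = ∀ {k} → k ∈ ks → 100 ≤ from k × to k ≤ 700

okKnots-sound : ∀ {x y p l h b c} ks → T (okKnots x y p l h b c ks) → ∀ {k} → k ∈ ks →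
  to k * p ≤ x ⊎ y ≤ from k * p ⊎ (lower k * b ≤ l × h ≤ upper k * c)
okKnots-sound (knot s e σ τ ∷ ks) ok (there k∈) = okKnots-sound ks (proj₂ (∧-elim ok)) k∈
okKnots-sound (knot s e σ τ ∷ ks) ok (here refl) with ∨-elim (proj₁ (∧-elim ok))
... | inj₁ e≤ = inj₁ (≤ᵇ⇒≤ _ _ e≤)
... | inj₂ r with ∨-elim r
...   | inj₁ ≤s = inj₂ (inj₁ (≤ᵇ⇒≤ _ _ ≤s))
...   | inj₂ r₂ with ∧-elim r₂
...     | σ≤ , ≤τ = inj₂ (inj₂ (≤ᵇ⇒≤ _ _ σ≤ , ≤ᵇ⇒≤ _ _ ≤τ))

module _ {ks : List Knot} (range : InRange ks) {κ l h : ℕ} {k : Knot} (k∈ : k ∈ ks) where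

  Located : ℕ → ℕ → Set
  Located p q = to k * p ≤ 100 * κ ⊎ 100 * (2 + κ) ≤ from k * p ⊎
    (lower k * (q * (2 + κ)) ≤ 25 * p * l × 25 * p * h ≤ upper k * (q * κ))

  private
    beyond : ∀ p q s → 2 + κ ≤ p → Located (p * 7 ^ s) (q * 4 ^ s)
    beyond p q s κ< = inj₂ (inj₁ (*-mono-≤ (proj₁ (range k∈))
      (≤-trans κ< (m≤m*n p (7 ^ s) {{m^n≢0 7 s}}))))

    shift : ∀ b p s → b * p * b ^ s ≡ p * b ^ suc s
    shift b p s = rearrange b p (b ^ s)
      where
      rearrange : ∀ b p x → b * p * x ≡ p * (b * x)
      rearrange = solve-∀

  -- Here `n` is the remaining fuel and `s` the number of scales between the current one and the one
  -- asked for. If the run stops before reaching it, the gap lies below all knots of that scale.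
  okScales-sound : ∀ n p q s → T (okScales ks κ l h n p q) → Located (p * 7 ^ s) (q * 4 ^ s)
  okScales-sound zero    p q s ok = beyond p q s (≤ᵇ⇒≤ _ _ ok)
  okScales-sound (suc n) p q s ok with ∨-elim {2 + κ ≤ᵇ p} ok
  ... | inj₁ κ< = beyond p q s (≤ᵇ⇒≤ _ _ κ<)
  okScales-sound (suc n) p q (suc s) ok | inj₂ r =
    subst₂ Located (shift 7 p s) (shift 4 q s)
      (okScales-sound n (7 * p) (4 * q) s (proj₂ (∧-elim r)))
  okScales-sound (suc n) p q zero ok | inj₂ r =
    subst₂ Located (sym (*-identityʳ p)) (sym (*-identityʳ q)) unit
    where
    open ≤-Reasoning
    unit : Located p q
    unit with ∨-elim {7 * p ≤ᵇ κ} (proj₁ (∧-elim r))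
    ... | inj₂ ok′ = okKnots-sound ks ok′ k∈
    ... | inj₁ ≤κ = inj₁ (begin
      to k * p      ≤⟨ *-monoˡ-≤ p (proj₂ (range k∈)) ⟩
      700 * p       ≡⟨ *-assoc 100 7 p ⟩
      100 * (7 * p) ≤⟨ *-monoʳ-≤ 100 (≤ᵇ⇒≤ (7 * p) κ ≤κ) ⟩
      100 * κ       ∎)

module _ {ks : List Knot} (range : InRange ks) {m n κ l h f g : ℕ} (1≤κ : 1 ≤ κ)
         (ok : T (okScales ks κ l h m 1 1))
         (l≤f : 4 ^ n * l ≤ 4 * f) (f≤h : 4 * f ≤ 4 ^ n * h)
         (κ≤g : 7 ^ n * κ ≤ g) (g≤κ : g < 7 ^ n * (2 + κ)) where
  open ≤-Reasoning

  private
    -- As κ ≥ 1, the gap is at least 7ⁿ, beyond every knot of a scale below n. So after division by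
    -- 7ⁿ only the scales 7ˢ with s ≥ 0 remain, which are those that `okScales` visits.
    level : ∀ a {k} → k ∈ ks → 100 * g < to k * 7 ^ a → n ≤ a
    level a {k} k∈ g< with n ≤? a
    ... | yes n≤a = n≤a
    ... | no  n≰a = contradiction g< (≤⇒≯ (begin
      to k * 7 ^ a       ≤⟨ *-monoˡ-≤ (7 ^ a) (proj₂ (range k∈)) ⟩
      700 * 7 ^ a         ≡⟨ *-assoc 100 7 (7 ^ a) ⟩
      100 * 7 ^ suc a     ≤⟨ *-monoʳ-≤ 100 (^-monoʳ-≤ 7 (≰⇒> n≰a)) ⟩
      100 * 7 ^ n         ≡⟨ cong (100 *_) (*-identityʳ (7 ^ n)) ⟨
      100 * (7 ^ n * 1)   ≤⟨ *-monoʳ-≤ 100 (*-monoʳ-≤ (7 ^ n) 1≤κ) ⟩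
      100 * (7 ^ n * κ)   ≤⟨ *-monoʳ-≤ 100 κ≤g ⟩
      100 * g             ∎))

    swap : ∀ x y z → x * (y * z) ≡ y * (x * z)
    swap = solve-∀

    swap′ : ∀ x y z → x * (y * z) ≡ y * z * x
    swap′ = solve-∀

    regroup : ∀ x y z w v → x * (y * z * (w * v)) ≡ y * w * (x * (z * v))
    regroup = solve-∀

    regroup′ : ∀ x y z w → x * y * (25 * z * w) ≡ 25 * (y * z) * (x * w)
    regroup′ = solve-∀

    quadruple : ∀ x y z → 25 * (x * y) * (4 * z) ≡ 100 * (x * y * z)
    quadruple = solve-∀

    bounds : ∀ s {k} → k ∈ ks →
      from k * (7 ^ n * 7 ^ s) ≤ 100 * g → 100 * g < to k * (7 ^ n * 7 ^ s) →
      lower k * (4 ^ n * 4 ^ s * g) ≤ 100 * (7 ^ n * 7 ^ s * f) ×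
      100 * (7 ^ n * 7 ^ s * f) ≤ upper k * (4 ^ n * 4 ^ s * g)
    bounds s {k} k∈ s≤ <e
      with subst₂ (Located range {κ} {l} {h} k∈) (*-identityˡ (7 ^ s)) (*-identityˡ (4 ^ s))
             (okScales-sound range k∈ m 1 1 s ok)
    ... | inj₁ e≤ = contradiction <e (≤⇒≯ (begin
      to k * (7 ^ n * 7 ^ s)   ≡⟨ swap (to k) (7 ^ n) (7 ^ s) ⟩
      7 ^ n * (to k * 7 ^ s)   ≤⟨ *-monoʳ-≤ (7 ^ n) e≤ ⟩
      7 ^ n * (100 * κ)         ≡⟨ swap (7 ^ n) 100 κ ⟩
      100 * (7 ^ n * κ)         ≤⟨ *-monoʳ-≤ 100 κ≤g ⟩
      100 * g                   ∎))
    ... | inj₂ (inj₁ ≤s) = contradiction s≤ (<⇒≱ (begin-strict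
      100 * g                       <⟨ *-monoʳ-< 100 g≤κ ⟩
      100 * (7 ^ n * (2 + κ))       ≡⟨ swap 100 (7 ^ n) (2 + κ) ⟩
      7 ^ n * (100 * (2 + κ))       ≤⟨ *-monoʳ-≤ (7 ^ n) ≤s ⟩
      7 ^ n * (from k * 7 ^ s)     ≡⟨ swap (7 ^ n) (from k) (7 ^ s) ⟩
      from k * (7 ^ n * 7 ^ s)     ∎))
    ... | inj₂ (inj₂ (σ≤ , ≤τ)) = (begin
      lower k * (4 ^ n * 4 ^ s * g)
        ≤⟨ *-monoʳ-≤ (lower k) (*-monoʳ-≤ (4 ^ n * 4 ^ s) (<⇒≤ g≤κ)) ⟩
      lower k * (4 ^ n * 4 ^ s * (7 ^ n * (2 + κ)))
        ≡⟨ regroup (lower k) (4 ^ n) (4 ^ s) (7 ^ n) (2 + κ) ⟩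
      4 ^ n * 7 ^ n * (lower k * (4 ^ s * (2 + κ)))
        ≤⟨ *-monoʳ-≤ (4 ^ n * 7 ^ n) σ≤ ⟩
      4 ^ n * 7 ^ n * (25 * 7 ^ s * l)
        ≡⟨ regroup′ (4 ^ n) (7 ^ n) (7 ^ s) l ⟩
      25 * (7 ^ n * 7 ^ s) * (4 ^ n * l)
        ≤⟨ *-monoʳ-≤ (25 * (7 ^ n * 7 ^ s)) l≤f ⟩
      25 * (7 ^ n * 7 ^ s) * (4 * f)
        ≡⟨ quadruple (7 ^ n) (7 ^ s) f ⟩
      100 * (7 ^ n * 7 ^ s * f) ∎) , (begin
      100 * (7 ^ n * 7 ^ s * f)
        ≡⟨ quadruple (7 ^ n) (7 ^ s) f ⟨
      25 * (7 ^ n * 7 ^ s) * (4 * f)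
        ≤⟨ *-monoʳ-≤ (25 * (7 ^ n * 7 ^ s)) f≤h ⟩
      25 * (7 ^ n * 7 ^ s) * (4 ^ n * h)
        ≡⟨ regroup′ (4 ^ n) (7 ^ n) (7 ^ s) h ⟨
      4 ^ n * 7 ^ n * (25 * 7 ^ s * h)
        ≤⟨ *-monoʳ-≤ (4 ^ n * 7 ^ n) ≤τ ⟩
      4 ^ n * 7 ^ n * (upper k * (4 ^ s * κ))
        ≡⟨ regroup (upper k) (4 ^ n) (4 ^ s) (7 ^ n) κ ⟨
      upper k * (4 ^ n * 4 ^ s * (7 ^ n * κ))
        ≤⟨ *-monoʳ-≤ (upper k) (*-monoʳ-≤ (4 ^ n * 4 ^ s) κ≤g) ⟩
      upper k * (4 ^ n * 4 ^ s * g) ∎)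

  okScales⇒Bounded : Bounded ks f g
  okScales⇒Bounded a {k} k∈ s≤ <e with m≤n⇒∃[o]m+o≡n (level a k∈ <e)
  ... | s , refl rewrite ^-distribˡ-+-* 7 n s | ^-distribˡ-+-* 4 n s = bounds s k∈ s≤ <e

knot-range : ∀ {k} → k ∈ knots → 100 ≤ from k × to k ≤ 700
knot-range = All.lookup (from-yes (All.all? (λ k → (100 ≤? from k) ×-dec (to k ≤? 700)) knots))


opaque
  unfolding passes

  passes⇒Bounded : ∀ {n κ l h f g} → 1 ≤ κ → T (passes κ l h) →
    4 ^ n * l ≤ 4 * f → 4 * f ≤ 4 ^ n * h →
    7 ^ n * κ ≤ g → g < 7 ^ n * (2 + κ) → Bounded knots f g
  passes⇒Bounded {n} {κ} {l} {h} {f} {g} 1≤κ ok = okScales⇒Bounded knot-range {5} {n} {κ} {l} {h} {f} {g} 1≤κ ok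

-- Positions in blocks

hull-hi : ∀ t i c → 12 * count (children t) i c + hi (child t i) c ≤ 4 * toℕ i + 4 * hi t c
hull-hi t i c = ≤ᵇ⇒≤ (12 * count (children t) i c + hi (child t i) c) (4 * toℕ i + 4 * hi t c)
  (proj₁ (∧-elim {12 * count (children t) i c + hi (child t i) c ≤ᵇ 4 * toℕ i + 4 * hi t c} (hull-checked t i c)))

hull-lo : ∀ t i c → 4 * toℕ i + lo (child t i) c ≤ 12 * count (children t) i c + 4 * lo t c
hull-lo t i c = ≤ᵇ⇒≤ (4 * toℕ i + lo (child t i) c) (12 * count (children t) i c + 4 * lo t c)
  (proj₂ (∧-elim {12 * count (children t) i c + hi (child t i) c ≤ᵇ 4 * toℕ i + 4 * hi t c} (hull-checked t i c)))

-- Blocks are half-open: an end point belongs to the next block, so a block of level 0 has its start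
-- as only position. The last equation of `inside` is the net displacement of the `i` preceding
-- siblings, with subtractions cleared.
data Pos : ℕ → Block → ℕ → (Step → ℕ) → Set where
  origin : ∀ {t x} → (∀ c → x c ≡ 0) → Pos 0 t 0 x
  inside : ∀ {n t g g′ x x′} i → Pos n (child t i) g′ x′ →
           g ≡ 7 ^ n * toℕ i + g′ →
           (∀ c → 3 * x c + 4 ^ n * toℕ i ≡
                  7 ^ n * toℕ i + 4 ^ n * (3 * count (children t) i c) + 3 * x′ c) →
           Pos (suc n) t g x

Pos-< : ∀ {n t g x} → Pos n t g x → g < 7 ^ n
Pos-< (origin _) = ≤-refl
Pos-< {suc n} (inside {g′ = g′} i q refl _) = begin-strict
  7 ^ n * toℕ i + g′      <⟨ +-monoʳ-< (7 ^ n * toℕ i) (Pos-< q) ⟩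
  7 ^ n * toℕ i + 7 ^ n   ≡⟨ +-comm (7 ^ n * toℕ i) (7 ^ n) ⟩
  7 ^ n + 7 ^ n * toℕ i   ≡⟨ *-suc (7 ^ n) (toℕ i) ⟨
  7 ^ n * suc (toℕ i)     ≤⟨ *-monoʳ-≤ (7 ^ n) (toℕ<n i) ⟩
  7 ^ n * 7               ≡⟨ *-comm (7 ^ n) 7 ⟩
  7 ^ suc n               ∎
  where open ≤-Reasoning

Pos-hi : ∀ {n t g x} → Pos n t g x → ∀ c → 4 * (3 * x c) ≤ 4 * g + 4 ^ n * hi t c
Pos-hi (origin x≡0) c rewrite x≡0 c = z≤n
Pos-hi {suc n} {t} {x = x} (inside {g′ = g′} {x′ = x′} i q refl eq) c =
  +-cancelʳ-≤ (4 * (4 ^ n * toℕ i)) _ _ (begin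
    4 * (3 * x c) + 4 * (K * toℕ i)
      ≡⟨ *-distribˡ-+ 4 (3 * x c) _ ⟨
    4 * (3 * x c + K * toℕ i)
      ≡⟨ cong (4 *_) (eq c) ⟩
    4 * (L * toℕ i + K * (3 * #) + 3 * x′ c)
      ≡⟨ expand L (toℕ i) K # (3 * x′ c) ⟩
    4 * (L * toℕ i) + K * (12 * #) + 4 * (3 * x′ c)
      ≤⟨ +-monoʳ-≤ (4 * (L * toℕ i) + K * (12 * #)) (Pos-hi q c) ⟩
    4 * (L * toℕ i) + K * (12 * #) + (4 * g′ + K * hi (child t i) c)
      ≡⟨ collect L (toℕ i) K (12 * #) g′ (hi (child t i) c) ⟩
    4 * (L * toℕ i + g′) + K * (12 * # + hi (child t i) c)
      ≤⟨ +-monoʳ-≤ (4 * (L * toℕ i + g′)) (*-monoʳ-≤ K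
           (hull-hi t i c)) ⟩
    4 * (L * toℕ i + g′) + K * (4 * toℕ i + 4 * hi t c)
      ≡⟨ split (4 * (L * toℕ i + g′)) K (toℕ i) (hi t c) ⟩
    4 * (L * toℕ i + g′) + 4 ^ suc n * hi t c + 4 * (K * toℕ i) ∎)
  where
  open ≤-Reasoning
  K = 4 ^ n
  L = 7 ^ n
  # = count (children t) i c
  expand : ∀ l i k a y → 4 * (l * i + k * (3 * a) + y) ≡ 4 * (l * i) + k * (12 * a) + 4 * y
  expand = solve-∀
  collect : ∀ l i k a g h → 4 * (l * i) + k * a + (4 * g + k * h) ≡ 4 * (l * i + g) + k * (a + h)
  collect = solve-∀
  split : ∀ a k i h → a + k * (4 * i + 4 * h) ≡ a + (4 * k) * h + 4 * (k * i)
  split = solve-∀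

Pos-lo : ∀ {n t g x} → Pos n t g x → ∀ c → 4 * g ≤ 4 * (3 * x c) + 4 ^ n * lo t c
Pos-lo (origin x≡0) c = z≤n
Pos-lo {suc n} {t} {x = x} (inside {g′ = g′} {x′ = x′} i q refl eq) c =
  +-cancelʳ-≤ (K * (12 * #)) _ _ (begin
    4 * (L * toℕ i + g′) + K * (12 * #)
      ≡⟨ expand (L * toℕ i) g′ (K * (12 * #)) ⟩
    4 * (L * toℕ i) + K * (12 * #) + 4 * g′
      ≤⟨ +-monoʳ-≤ (4 * (L * toℕ i) + K * (12 * #)) (Pos-lo q c) ⟩
    4 * (L * toℕ i) + K * (12 * #) + (4 * (3 * x′ c) + K * lo (child t i) c)
      ≡⟨ collect (L * toℕ i) K # (3 * x′ c) (lo (child t i) c) ⟩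
    4 * (L * toℕ i + K * (3 * #) + 3 * x′ c) + K * lo (child t i) c
      ≡⟨ cong (λ y → 4 * y + K * lo (child t i) c) (eq c) ⟨
    4 * (3 * x c + K * toℕ i) + K * lo (child t i) c
      ≡⟨ collect′ (3 * x c) K (toℕ i) (lo (child t i) c) ⟩
    4 * (3 * x c) + K * (4 * toℕ i + lo (child t i) c)
      ≤⟨ +-monoʳ-≤ (4 * (3 * x c)) (*-monoʳ-≤ K
           (hull-lo t i c)) ⟩
    4 * (3 * x c) + K * (12 * # + 4 * lo t c)
      ≡⟨ split (4 * (3 * x c)) K (12 * #) (lo t c) ⟩
    4 * (3 * x c) + 4 ^ suc n * lo t c + K * (12 * #) ∎)
  where
  open ≤-Reasoning
  K = 4 ^ n
  L = 7 ^ n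
  # = count (children t) i c
  expand : ∀ l g a → 4 * (l + g) + a ≡ 4 * l + a + 4 * g
  expand = solve-∀
  collect : ∀ l k a y h → 4 * l + k * (12 * a) + (4 * y + k * h) ≡ 4 * (l + k * (3 * a) + y) + k * h
  collect = solve-∀
  collect′ : ∀ y k i h → 4 * (y + k * i) + k * h ≡ 4 * y + k * (4 * i + h)
  collect′ = solve-∀
  split : ∀ a k i h → a + k * (i + 4 * h) ≡ a + (4 * k) * h + k * i
  split = solve-∀

-- Positions in blocks t and u of level n that are preceded by k and l blocks.  In the projection
-- the blocks start 4ⁿ (p - m) apart, and the positions lie U - V apart; subtractions are avoided.
record State (n : ℕ) (t u : Block) (p m : Step → ℕ) (k l : ℕ) (U V : Step → ℕ) (g : ℕ) : Set where
  constructor state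
  field
    {g₁ g₂} : ℕ
    {x₁ x₂} : Step → ℕ
    pos₁    : Pos n t g₁ x₁
    pos₂    : Pos n u g₂ x₂
    shift   : ∀ c → U c + 4 ^ n * m c + (3 * x₁ c + g₂) ≡ V c + 4 ^ n * p c + (3 * x₂ c + g₁)
    gap     : g + 7 ^ n * k + g₁ ≡ 7 ^ n * l + g₂

-- Only p - m and l - k matter. Cancelling common summands restores the normal forms from which the
-- inductions proceed.
reduce : ∀ {n t u p p′ m m′ k k′ l l′ U V g} (r : Step → ℕ) s →
  (∀ c → p c ≡ p′ c + r c) → (∀ c → m c ≡ m′ c + r c) → k ≡ k′ + s → l ≡ l′ + s →
  State n t u p m k l U V g → State n t u p′ m′ k′ l′ U V g
reduce {n} {p′ = p′} {m′ = m′} {k′ = k′} {l′ = l′} {U = U} {V} {g} r s p≡ m≡ refl refl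
       (state {g₁} {g₂} {x₁} {x₂} pos₁ pos₂ shift gap) = state pos₁ pos₂
  (λ c → +-cancelʳ-≡ (4 ^ n * r c) _ _ (begin
    U c + 4 ^ n * m′ c + (3 * x₁ c + g₂) + 4 ^ n * r c
      ≡⟨ regroup (U c) (4 ^ n) (m′ c) (r c) (3 * x₁ c + g₂) ⟩
    U c + 4 ^ n * (m′ c + r c) + (3 * x₁ c + g₂)
      ≡⟨ cong (λ y → U c + 4 ^ n * y + (3 * x₁ c + g₂)) (m≡ c) ⟨
    _ ≡⟨ shift c ⟩
    _ ≡⟨ cong (λ y → V c + 4 ^ n * y + (3 * x₂ c + g₁)) (p≡ c) ⟩
    V c + 4 ^ n * (p′ c + r c) + (3 * x₂ c + g₁)
      ≡⟨ regroup (V c) (4 ^ n) (p′ c) (r c) (3 * x₂ c + g₁) ⟨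
    V c + 4 ^ n * p′ c + (3 * x₂ c + g₁) + 4 ^ n * r c ∎))
  (+-cancelʳ-≡ (7 ^ n * s) _ _ (begin
    g + 7 ^ n * k′ + g₁ + 7 ^ n * s   ≡⟨ regroup g (7 ^ n) k′ s g₁ ⟩
    g + 7 ^ n * (k′ + s) + g₁         ≡⟨ gap ⟩
    7 ^ n * (l′ + s) + g₂             ≡⟨ regroup 0 (7 ^ n) l′ s g₂ ⟨
    7 ^ n * l′ + g₂ + 7 ^ n * s       ∎))
  where
  open ≡-Reasoning
  regroup : ∀ a k x y b → a + k * x + b + k * y ≡ a + k * (x + y) + b
  regroup = solve-∀

descend : ∀ {n t u p m k l U V g} → State (suc n) t u p m k l U V g →
  ∃₂ λ i j → State n (child t i) (child u j) (plus u p i j) (minus t m i j)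
                   (7 * k + toℕ i) (7 * l + toℕ j) U V g
descend {n} {t} {u} {p} {m} {k} {l} {U} {V} {g}
        (state {x₁ = x₁} {x₂} (inside {g′ = g₁} {x′ = x₁′} i pos₁ refl eq₁)
                              (inside {g′ = g₂} {x′ = x₂′} j pos₂ refl eq₂) shift gap) =
  i , j , state pos₁ pos₂
  -- The two position equations are added to `shift` with opposite orientations, after which the
  -- counts of the parent positions stand on both sides.
  (λ c → +-cancelʳ-≡ (3 * x₁ c + 3 * x₂ c + L * toℕ i + L * toℕ j) _ _ (begin
    U c + K * (4 * m c + (#₁ c + toℕ j)) + (3 * x₁′ c + g₂) + (3 * x₁ c + 3 * x₂ c + L * toℕ i + L * toℕ j)
      ≡⟨ lhs (U c) K (m c) (#₁ c) (toℕ j) (3 * x₁′ c) g₂ (3 * x₁ c) (3 * x₂ c) (L * toℕ i) (L * toℕ j) ⟩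
    (U c + 4 ^ suc n * m c + (3 * x₁ c + (L * toℕ j + g₂))) + (L * toℕ i + K * #₁ c + 3 * x₁′ c) + (3 * x₂ c + K * toℕ j)
      ≡⟨ cong₂ _+_ (cong₂ _+_ (shift c) (sym (eq₁ c))) (eq₂ c) ⟩
    (V c + 4 ^ suc n * p c + (3 * x₂ c + (L * toℕ i + g₁))) + (3 * x₁ c + K * toℕ i) + (L * toℕ j + K * #₂ c + 3 * x₂′ c)
      ≡⟨ rhs (V c) K (p c) (#₂ c) (toℕ i) (3 * x₂′ c) g₁ (3 * x₁ c) (3 * x₂ c) (L * toℕ i) (L * toℕ j) ⟩
    V c + K * (4 * p c + (#₂ c + toℕ i)) + (3 * x₂′ c + g₁) + (3 * x₁ c + 3 * x₂ c + L * toℕ i + L * toℕ j) ∎))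
  (begin
    g + L * (7 * k + toℕ i) + g₁            ≡⟨ gapˡ g L k (toℕ i) g₁ ⟩
    g + 7 ^ suc n * k + (L * toℕ i + g₁)    ≡⟨ gap ⟩
    7 ^ suc n * l + (L * toℕ j + g₂)        ≡⟨ gapˡ 0 L l (toℕ j) g₂ ⟨
    L * (7 * l + toℕ j) + g₂                ∎)
  where
  open ≡-Reasoning
  K = 4 ^ n
  L = 7 ^ n
  #₁ #₂ : Step → ℕ
  #₁ c = 3 * count (children t) i c
  #₂ c = 3 * count (children u) j c
  lhs : ∀ U K m a j y₁ g₂ x₁ x₂ Li Lj →
    U + K * (4 * m + (a + j)) + (y₁ + g₂) + (x₁ + x₂ + Li + Lj) ≡
    (U + 4 * K * m + (x₁ + (Lj + g₂))) + (Li + K * a + y₁) + (x₂ + K * j)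
  lhs = solve-∀
  rhs : ∀ V K p a i y₂ g₁ x₁ x₂ Li Lj →
    (V + 4 * K * p + (x₂ + (Li + g₁))) + (x₁ + K * i) + (Lj + K * a + y₂) ≡
    V + K * (4 * p + (a + i)) + (y₂ + g₁) + (x₁ + x₂ + Li + Lj)
  rhs = solve-∀
  gapˡ : ∀ g L k i g₁ → g + L * (7 * k + i) + g₁ ≡ g + 7 * L * k + (L * i + g₁)
  gapˡ = solve-∀

count-zero : ∀ t c → count (children t) 0F c ≡ 0
count-zero (θ , false) c = refl
count-zero (θ , true)  c = refl

-- A single step cannot be subdivided, so it is magnified to a block of level 1 whose first child
-- holds the position. Displacements grow by 4 and gaps by 7, which `Bounded-descend` undoes.
descend₀ : ∀ {t u p m k l U V g} → State 0 t u p m k l U V g →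
  State 0 (child t 0F) (child u 0F) (plus u p 0F 0F) (minus t m 0F 0F) (7 * k + 0) (7 * l + 0)
        (λ c → 4 * U c) (λ c → 4 * V c) (7 * g)
descend₀ {t} {u} {p} {m} {k} {l} {U} {V} {g} (state {x₁ = x₁} {x₂} (origin z₁) (origin z₂) shift gap) =
  state (origin z₁) (origin z₂) shift′ (begin
    7 * g + 1 * (7 * k + 0) + 0 ≡⟨ gapˡ g k ⟩
    7 * (g + 1 * k + 0)         ≡⟨ cong (7 *_) gap ⟩
    7 * (1 * l + 0)             ≡⟨ gapˡ 0 l ⟨
    1 * (7 * l + 0) + 0         ∎)
  where
  open ≡-Reasoning
  gapˡ : ∀ g k → 7 * g + 1 * (7 * k + 0) + 0 ≡ 7 * (g + 1 * k + 0)
  gapˡ = solve-∀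
  quadruple : ∀ U m → 4 * U + 1 * (4 * m + (3 * 0 + 0)) + (3 * 0 + 0) ≡ 4 * (U + 1 * m + (3 * 0 + 0))
  quadruple = solve-∀
  shift′ : ∀ c → 4 * U c + 1 * minus t m 0F 0F c + (3 * x₁ c + 0) ≡
                 4 * V c + 1 * plus u p 0F 0F c + (3 * x₂ c + 0)
  shift′ c with shift c
  ... | eq rewrite z₁ c | z₂ c | count-zero t c | count-zero u c =
    trans (quadruple (U c) (m c)) (trans (cong (4 *_) eq) (sym (quadruple (V c) (p c))))

φ-* : ∀ U V → φ (λ c → 4 * U c) (λ c → 4 * V c) ≡ 4 * φ U V
φ-* U V = trans (max-cong λ c → begin
  3 * (4 * U c ∸ 4 * V c) ⊔′ 4 * (4 * V c ∸ 4 * U c)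
    ≡⟨ cong₂ (λ x y → 3 * x ⊔′ 4 * y) (*-distribˡ-∸ 4 (U c) (V c)) (*-distribˡ-∸ 4 (V c) (U c)) ⟨
  3 * (4 * (U c ∸ V c)) ⊔′ 4 * (4 * (V c ∸ U c))
    ≡⟨ cong (_⊔′ 4 * (4 * (V c ∸ U c))) (swap 3 (U c ∸ V c)) ⟩
  4 * (3 * (U c ∸ V c)) ⊔′ 4 * (4 * (V c ∸ U c))
    ≡⟨ *-distribˡ-⊔′ 4 (3 * (U c ∸ V c)) (4 * (V c ∸ U c)) ⟨
  4 * dev (U c) (V c) ∎)
  (sym (*-distribˡ-max 4 λ c → dev (U c) (V c)))
  where
  open ≡-Reasoning
  swap : ∀ a x → a * (4 * x) ≡ 4 * (a * x)
  swap = solve-∀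

-- The hypothesis at scale `suc a` is 28 = 4 · 7 times the conclusion at scale `a`.
Bounded-descend : ∀ {ks f g} → Bounded ks (4 * f) (7 * g) → Bounded ks f g
Bounded-descend {ks} {f} {g} b a {k} k∈ s≤ <e =
  *-cancelˡ-≤ {lower k * (4 ^ a * g)} {100 * (7 ^ a * f)} 28 (begin
    28 * (lower k * (4 ^ a * g))            ≡⟨ left (lower k) (4 ^ a) g ⟨
    lower k * (4 ^ suc a * (7 * g))         ≤⟨ proj₁ bounds ⟩
    100 * (7 ^ suc a * (4 * f))             ≡⟨ right (7 ^ a) f ⟩
    28 * (100 * (7 ^ a * f))                ∎) ,
  *-cancelˡ-≤ {100 * (7 ^ a * f)} {upper k * (4 ^ a * g)} 28 (begin
    28 * (100 * (7 ^ a * f))                ≡⟨ right (7 ^ a) f ⟨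
    100 * (7 ^ suc a * (4 * f))             ≤⟨ proj₂ bounds ⟩
    upper k * (4 ^ suc a * (7 * g))         ≡⟨ left (upper k) (4 ^ a) g ⟩
    28 * (upper k * (4 ^ a * g))            ∎)
  where
  open ≤-Reasoning
  swap : ∀ k x y → k * (x * y) ≡ x * (k * y)
  swap = solve-∀
  left : ∀ k x g → k * (4 * x * (7 * g)) ≡ 28 * (k * (x * g))
  left = solve-∀
  right : ∀ x f → 100 * (7 * x * (4 * f)) ≡ 28 * (100 * (x * f))
  right = solve-∀
  bounds : lower k * (4 ^ suc a * (7 * g)) ≤ 100 * (7 ^ suc a * (4 * f)) ×
           100 * (7 ^ suc a * (4 * f)) ≤ upper k * (4 ^ suc a * (7 * g))
  bounds = b (suc a) k∈
    (begin
      from k * 7 ^ suc a     ≡⟨ swap (from k) 7 (7 ^ a) ⟩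
      7 * (from k * 7 ^ a)   ≤⟨ *-monoʳ-≤ 7 s≤ ⟩
      7 * (100 * g)          ≡⟨ swap 7 100 g ⟩
      100 * (7 * g)          ∎)
    (begin-strict
      100 * (7 * g)          ≡⟨ swap 7 100 g ⟨
      7 * (100 * g)          <⟨ *-monoʳ-< 7 <e ⟩
      7 * (to k * 7 ^ a)     ≡⟨ swap (to k) 7 (7 ^ a) ⟨
      to k * 7 ^ suc a       ∎)

-- Soundness of the search and the induction over levels

tabulate-! : ∀ f c → tabulate f ! c ≡ f c
tabulate-! f 𝐢 = refl
tabulate-! f 𝐣 = refl
tabulate-! f 𝐤 = refl

sep+ : ∀ i j → sep i j + toℕ i ≡ 6 + toℕ j
sep+ i j = begin
  toℕ (opposite i) + toℕ j + toℕ i    ≡⟨ swap (toℕ (opposite i)) (toℕ j) (toℕ i) ⟩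
  toℕ (opposite i) + toℕ i + toℕ j    ≡⟨ cong (λ x → x + toℕ i + toℕ j) (Fin.opposite-prop i) ⟩
  6 ∸ toℕ i + toℕ i + toℕ j           ≡⟨ cong (_+ toℕ j) (m∸n+n≡m (toℕ≤pred[n] i)) ⟩
  6 + toℕ j                           ∎
  where
  open ≡-Reasoning
  swap : ∀ a b c → a + b + c ≡ a + c + b
  swap = solve-∀

test-sound : ∀ {n t u p m κ k l U V g} → T (test t u p m κ) → 1 ≤ κ → l ≡ k + suc κ →
  State n t u (p !_) (m !_) k l U V g → Bounded knots (φ U V) g
test-sound {n} {t} {u} {p} {m} {κ} {k} {U = U} {V} {g} ok 1≤κ refl
           (state {g₁} {g₂} {x₁} {x₂} pos₁ pos₂ shift gap) =
  passes⇒Bounded {n} {κ} {max least′} {max most′} {φ U V} {g} 1≤κ ok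
    (subst₂ _≤_ (sym (*-distribˡ-max (4 ^ n) least′)) (sym (*-distribˡ-max 4 dev′))
      (max-mono-≤ λ c → least≤dev (4 ^ n) {U c} {V c} {a c} {b c} {x c} {y c} (upper-bound c) (lower-bound c)))
    (subst₂ _≤_ (sym (*-distribˡ-max 4 dev′)) (sym (*-distribˡ-max (4 ^ n) most′))
      (max-mono-≤ λ c → dev≤most (4 ^ n) {U c} {V c} {a c} {b c} {x c} {y c} (upper-bound c) (lower-bound c)))
    (+-cancelʳ-≤ g₁ _ _ (begin
      7 ^ n * κ + g₁          ≤⟨ +-monoʳ-≤ (7 ^ n * κ) (<⇒≤ (Pos-< pos₁)) ⟩
      7 ^ n * κ + 7 ^ n       ≡⟨ +-comm (7 ^ n * κ) (7 ^ n) ⟩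
      7 ^ n + 7 ^ n * κ       ≡⟨ *-suc (7 ^ n) κ ⟨
      7 ^ n * suc κ           ≤⟨ m≤m+n _ g₂ ⟩
      7 ^ n * suc κ + g₂      ≡⟨ gap′ ⟨
      g + g₁                  ∎))
    (begin-strict
      g                       ≤⟨ m≤m+n g g₁ ⟩
      g + g₁                  ≡⟨ gap′ ⟩
      7 ^ n * suc κ + g₂      <⟨ +-monoʳ-< (7 ^ n * suc κ) (Pos-< pos₂) ⟩
      7 ^ n * suc κ + 7 ^ n   ≡⟨ +-comm (7 ^ n * suc κ) (7 ^ n) ⟩
      7 ^ n + 7 ^ n * suc κ   ≡⟨ *-suc (7 ^ n) (suc κ) ⟨
      7 ^ n * (2 + κ)         ∎)
  where
  open ≤-Reasoning
  a b x y least′ most′ dev′ : Step → ℕ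
  a c = 4 * (p ! c)
  b c = 4 * (m ! c)
  x c = hi u c + lo t c
  y c = lo u c + hi t c
  least′ c = least (a c) (b c) (x c) (y c)
  most′ c = most (a c) (b c) (x c) (y c)
  dev′ c = dev (U c) (V c)

  gap′ : g + g₁ ≡ 7 ^ n * suc κ + g₂
  gap′ = +-cancelʳ-≡ (7 ^ n * k) _ _ (trans (left g g₁ (7 ^ n * k)) (trans gap (right (7 ^ n) k κ g₂)))
    where
    left : ∀ a b c → a + b + c ≡ a + c + b
    left = solve-∀
    right : ∀ L k κ b → L * (k + suc κ) + b ≡ L * suc κ + b + L * k
    right = solve-∀

  upper-bound : ∀ c → 4 * U c + 4 ^ n * b c ≤ 4 * V c + 4 ^ n * (a c + x c)
  upper-bound c = +-cancelʳ-≤ (4 * (3 * x₁ c + g₂)) _ _ (begin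
    4 * U c + 4 ^ n * (4 * (m ! c)) + 4 * (3 * x₁ c + g₂)
      ≡⟨ left (U c) (4 ^ n) (m ! c) (3 * x₁ c + g₂) ⟩
    4 * (U c + 4 ^ n * (m ! c) + (3 * x₁ c + g₂))
      ≡⟨ cong (4 *_) (shift c) ⟩
    4 * (V c + 4 ^ n * (p ! c) + (3 * x₂ c + g₁))
      ≡⟨ right (V c) (4 ^ n) (p ! c) (3 * x₂ c) g₁ ⟩
    4 * V c + 4 ^ n * (4 * (p ! c)) + (4 * (3 * x₂ c) + 4 * g₁)
      ≤⟨ +-monoʳ-≤ (4 * V c + 4 ^ n * (4 * (p ! c))) (+-mono-≤ (Pos-hi pos₂ c) (Pos-lo pos₁ c)) ⟩
    4 * V c + 4 ^ n * (4 * (p ! c)) + (4 * g₂ + 4 ^ n * hi u c + (4 * (3 * x₁ c) + 4 ^ n * lo t c))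
      ≡⟨ final (4 * V c) (4 ^ n) (4 * (p ! c)) g₂ (hi u c) (3 * x₁ c) (lo t c) ⟩
    4 * V c + 4 ^ n * (4 * (p ! c) + (hi u c + lo t c)) + 4 * (3 * x₁ c + g₂) ∎)
    where
    left : ∀ U K m s → 4 * U + K * (4 * m) + 4 * s ≡ 4 * (U + K * m + s)
    left = solve-∀
    right : ∀ V K p s t → 4 * (V + K * p + (s + t)) ≡ 4 * V + K * (4 * p) + (4 * s + 4 * t)
    right = solve-∀
    final : ∀ V K p g h y l → V + K * p + (4 * g + K * h + (4 * y + K * l)) ≡
                              V + K * (p + (h + l)) + 4 * (y + g)
    final = solve-∀

  lower-bound : ∀ c → 4 * V c + 4 ^ n * a c ≤ 4 * U c + 4 ^ n * (b c + y c)
  lower-bound c = +-cancelʳ-≤ (4 * (3 * x₂ c + g₁)) _ _ (begin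
    4 * V c + 4 ^ n * (4 * (p ! c)) + 4 * (3 * x₂ c + g₁)
      ≡⟨ left (V c) (4 ^ n) (p ! c) (3 * x₂ c + g₁) ⟩
    4 * (V c + 4 ^ n * (p ! c) + (3 * x₂ c + g₁))
      ≡⟨ cong (4 *_) (shift c) ⟨
    4 * (U c + 4 ^ n * (m ! c) + (3 * x₁ c + g₂))
      ≡⟨ right (U c) (4 ^ n) (m ! c) (3 * x₁ c) g₂ ⟩
    4 * U c + 4 ^ n * (4 * (m ! c)) + (4 * g₂ + 4 * (3 * x₁ c))
      ≤⟨ +-monoʳ-≤ (4 * U c + 4 ^ n * (4 * (m ! c))) (+-mono-≤ (Pos-lo pos₂ c) (Pos-hi pos₁ c)) ⟩
    4 * U c + 4 ^ n * (4 * (m ! c)) + (4 * (3 * x₂ c) + 4 ^ n * lo u c + (4 * g₁ + 4 ^ n * hi t c))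
      ≡⟨ final (4 * U c) (4 ^ n) (4 * (m ! c)) g₁ (lo u c) (3 * x₂ c) (hi t c) ⟩
    4 * U c + 4 ^ n * (4 * (m ! c) + (lo u c + hi t c)) + 4 * (3 * x₂ c + g₁) ∎)
    where
    left : ∀ U K m s → 4 * U + K * (4 * m) + 4 * s ≡ 4 * (U + K * m + s)
    left = solve-∀
    right : ∀ V K p s t → 4 * (V + K * p + (s + t)) ≡ 4 * V + K * (4 * p) + (4 * t + 4 * s)
    right = solve-∀
    final : ∀ V K p g l y h → V + K * p + (4 * y + K * l + (4 * g + K * h)) ≡
                              V + K * (p + (l + h)) + 4 * (y + g)
    final = solve-∀

sep-gap : ∀ {k l κ} i j → l ≡ k + suc κ →
          7 * l + toℕ j ≡ 7 * k + toℕ i + suc (7 * κ + sep i j)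
sep-gap {k} {κ = κ} i j refl = +-cancelˡ-≡ 6 _ _ (begin
  6 + (7 * (k + suc κ) + toℕ j)                        ≡⟨ left (toℕ j) (7 * (k + suc κ)) ⟩
  6 + toℕ j + 7 * (k + suc κ)                          ≡⟨ cong (_+ 7 * (k + suc κ)) (sep+ i j) ⟨
  sep i j + toℕ i + 7 * (k + suc κ)                    ≡⟨ right (sep i j) (toℕ i) k κ ⟩
  6 + (7 * k + toℕ i + suc (7 * κ + sep i j))          ∎)
  where
  open ≡-Reasoning
  left : ∀ j a → 6 + (a + j) ≡ 6 + j + a
  left = solve-∀
  right : ∀ s i k κ → s + i + 7 * (k + suc κ) ≡ 6 + (7 * k + i + suc (7 * κ + s))
  right = solve-∀

check-sound : ∀ d {n t u p m κ k l U V g} → T (check d t u p m κ) → 1 ≤ κ → l ≡ k + suc κ →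
  State n t u (p !_) (m !_) k l U V g → Bounded knots (φ U V) g

checkChild-sound : ∀ d {n} t u p m {κ k l U V g} i j → T (checkChild d t u p m κ i j) →
  1 ≤ κ → l ≡ k + suc κ →
  State n (child t i) (child u j) (plus u p i j) (minus t m i j) k l U V g →
  Bounded knots (φ U V) g
checkChild-sound d t u p m {k = k} {l} i j ok 1≤κ l≡ s =
  check-sound d {p = tabulate (plus u p i j)} {m = tabulate (minus t m i j)} ok 1≤κ l≡
    (reduce (λ _ → 0) 0
      (λ c → trans (sym (tabulate-! (plus u p i j) c)) (sym (+-identityʳ _)))
      (λ c → trans (sym (tabulate-! (minus t m i j) c)) (sym (+-identityʳ _)))
      (sym (+-identityʳ k)) (sym (+-identityʳ l)) s)

check-sound zero {p = p} {m} ok 1≤κ l≡ s = test-sound {p = p} {m} ok 1≤κ l≡ s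
check-sound (suc d) {n} {t} {u} {p} {m} {κ} {k} {l} {U} {V} {g} ok 1≤κ l≡ s =
  [ (λ ok₁ → test-sound {p = p} {m} ok₁ 1≤κ l≡ s) , (λ ok₂ → go ok₂ n s) ]′ (∨-elim {test t u p m κ} ok)
  where
  1≤κ′ : ∀ i j → 1 ≤ 7 * κ + sep i j
  1≤κ′ i j = ≤-trans 1≤κ (≤-trans (m≤n*m κ 7) (m≤m+n (7 * κ) (sep i j)))

  row : Fin 7 → Fin 7 → Bool
  row i j = checkChild d t u (p !_) (m !_) (7 * κ + sep i j) i j

  ok′ : T (every λ i → every (row i)) → ∀ i j → T (row i j)
  ok′ ok₂ i j = every-sound (row i) (every-sound (λ i → every (row i)) ok₂ i) j

  go : T (every λ i → every (row i)) → ∀ n → State n t u (p !_) (m !_) k l U V g → Bounded knots (φ U V) g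
  go ok₂ zero s = Bounded-descend {f = φ U V} {g} (subst (λ f → Bounded knots f (7 * g)) (φ-* U V)
    (checkChild-sound d t u (p !_) (m !_) 0F 0F (ok′ ok₂ 0F 0F) (1≤κ′ 0F 0F) (sep-gap {k} {l} 0F 0F l≡) (descend₀ s)))
  go ok₂ (suc n) s = let i , j , s′ = descend s in
    checkChild-sound d t u (p !_) (m !_) i j (ok′ ok₂ i j) (1≤κ′ i j) (sep-gap {k} {l} i j l≡) s′

child-zero : ∀ t → child t 0F ≡ t
child-zero (θ , false) = refl
child-zero (θ , true)  = refl

child-six : ∀ t → child t 6F ≡ t
child-six (θ , false) = refl
child-six (θ , true)  = refl

count-six : ∀ t c → count (children t) 6F c ≡ 1 + 3 * axis t c
count-six t c = ≡ᵇ⇒≡ _ (1 + 3 * axis t c) (everyStep-sound (λ c → count (children t) 6F c ≡ᵇ 1 + 3 * axis t c)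
  (everyBlock-sound (λ t → everyStep λ c → count (children t) 6F c ≡ᵇ 1 + 3 * axis t c) refl t) c)

sep≡0 : ∀ i j → sep i j ≡ 0 → i ≡ 6F × j ≡ 0F
sep≡0 i j s≡0 = toℕ-injective (trans i≡ (cong (6 +_) j≡0)) , toℕ-injective j≡0
  where
  i≡ : toℕ i ≡ 6 + toℕ j
  i≡ = trans (cong (_+ toℕ i) (sym s≡0)) (sep+ i j)
  j≡0 : toℕ j ≡ 0
  j≡0 = n≤0⇒n≡0 (+-cancelˡ-≤ 6 (toℕ j) 0 (subst (_≤ 6) i≡ (toℕ≤pred[n] i)))

-- Descent along a junction: either both positions stay in the children that meet there, which
-- reproduces the situation one level lower, or some block separates them and the search applies.
-- Magnified single steps have six blocks between them.
next-bounded : ∀ n {t u U V g} → t ⋯ u →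
  State n t u (λ c → 3 * axis t c) (λ _ → 1) 0 1 U V g → Bounded knots (φ U V) g
next-bounded zero {t} {u} {U} {V} {g} t⋯u s =
  Bounded-descend {f = φ U V} {g} (subst (λ f → Bounded knots f (7 * g)) (φ-* U V)
    (checkChild-sound depth t u (λ c → 3 * axis t c) (λ _ → 1) 0F 0F (next-checked t⋯u 0F 0F)
      (s≤s z≤n) refl (descend₀ s)))
next-bounded (suc n) {t} {u} {U} {V} {g} t⋯u s = let i , j , s′ = descend s in
  cases i j (sep i j ≟ 0) s′
  where
  Child : Fin 7 → Fin 7 → Set
  Child i j = State n (child t i) (child u j)
    (plus u (λ c → 3 * axis t c) i j) (minus t (λ _ → 1) i j) (toℕ i) (7 + toℕ j) U V g

  plus≡ : ∀ x → 4 * (3 * x) + (3 * 0 + 6) ≡ 3 * x + (6 + 9 * x)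
  plus≡ = solve-∀
  minus≡ : ∀ x → 4 + (3 * (1 + 3 * x) + 0) ≡ 1 + (6 + 9 * x)
  minus≡ = solve-∀

  -- With a = `axis t c`, the first six children of `t` account for 9 a - 3 of its displacement 4 (3
  -- a - 1). What remains is 3 a - 1, so the smaller pair has the same offsets.
  corner : ∀ {i j} → i ≡ 6F × j ≡ 0F → Child i j → Bounded knots (φ U V) g
  corner (refl , refl) s =
    next-bounded n t⋯u (subst₂ (λ a b → State n a b (λ c → 3 * axis t c) (λ _ → 1) 0 1 U V g)
      (child-six t) (child-zero u)
      (reduce (λ c → 6 + 9 * axis t c) 6
        (λ c → trans (cong (λ x → 4 * (3 * axis t c) + (3 * x + 6)) (count-zero u c)) (plus≡ (axis t c)))
        (λ c → trans (cong (λ x → 4 + (3 * x + 0)) (count-six t c)) (minus≡ (axis t c)))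
        refl refl s))

  cases : ∀ i j → Dec (sep i j ≡ 0) → Child i j → Bounded knots (φ U V) g
  cases i j (yes s≡0) s = corner (sep≡0 i j s≡0) s
  cases i j (no s≢0)  s =
    [ (λ ≤0 → contradiction (n≤0⇒n≡0 (≤ᵇ⇒≤ (sep i j) 0 ≤0)) s≢0)
    , (λ ok → checkChild-sound depth t u (λ c → 3 * axis t c) (λ _ → 1) i j ok
                (n≢0⇒n>0 s≢0) (sep-gap {0} {1} i j refl) s)
    ]′ (∨-elim {sep i j ≤ᵇ 0} (next-checked t⋯u i j))

consecutive : ∀ t i → child t (inject₁ i) ⋯ child t (suc i)
consecutive (θ , false) 0F = ⋯₁
consecutive (θ , false) 1F = subst (λ x → (θ ·α , false) ⋯ (x ·β , true)) (·α-involutive θ) ⋯₂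
consecutive (θ , false) 2F = subst (λ x → (θ ·β , true) ⋯ (x , false)) (·β-involutive θ) ⋯₅
consecutive (θ , false) 3F = ⋯₃
consecutive (θ , false) 4F = subst (λ x → (θ ·β ·α , true) ⋯ (x , true)) (·α-involutive (θ ·β)) ⋯₄
consecutive (θ , false) 5F = subst (λ x → (θ ·β , true) ⋯ (x , false)) (·β-involutive θ) ⋯₅
consecutive (θ , true)  0F = ⋯₅
consecutive (θ , true)  1F = ⋯₁
consecutive (θ , true)  2F = subst (λ x → (θ ·β ·α , false) ⋯ (x , true))
  (trans (cong _·β (·α-involutive (θ ·β))) (·β-involutive θ)) ⋯₂
consecutive (θ , true)  3F = ⋯₅
consecutive (θ , true)  4F = subst (λ x → (θ ·β , false) ⋯ (x ·α , true)) (·β-involutive θ) ⋯₃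
consecutive (θ , true)  5F = subst (λ x → (θ ·α , true) ⋯ (x , true)) (·α-involutive θ) ⋯₄

count-suc : ∀ {m} (ts : Vec Block (suc m)) i c →
  count ts (suc i) c ≡ axis (lookup ts (inject₁ i)) c + count ts (inject₁ i) c
count-suc (t ∷ u ∷ ts) zero    c = refl
count-suc (t ∷ u ∷ ts) (suc i) c = trans (cong (axis t c +_) (count-suc (u ∷ ts) i c))
  (swap (axis t c) (axis (lookup (u ∷ ts) (inject₁ i)) c) (count (u ∷ ts) (inject₁ i) c))
  where
  swap : ∀ a b c → a + (b + c) ≡ b + (a + c)
  swap = solve-∀

-- Descends to the smallest block containing both positions, whose children then separate them. One
-- exists because g > 0 excludes a common position at level 0.
same-bounded : ∀ n t {U V g} → 0 < g →
  State n t t (λ _ → 0) (λ _ → 0) 0 0 U V g → Bounded knots (φ U V) g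
same-bounded zero t {g = g} 0<g (state (origin _) (origin _) _ gap) =
  contradiction (trans (sym (trans (+-identityʳ (g + 0)) (+-identityʳ g))) gap) (m<n⇒n≢0 0<g)
same-bounded (suc n) t {U} {V} {g} 0<g s = let i , j , s′ = descend s in
  cases i j (<-cmp (toℕ i) (toℕ j)) s′
  where
  # : Fin 7 → Step → ℕ
  # i c = count (children t) i c

  Child : Fin 7 → Fin 7 → Set
  Child i j = State n (child t i) (child t j)
    (plus t (λ _ → 0) i j) (minus t (λ _ → 0) i j) (toℕ i) (toℕ j) U V g

  coincide : ∀ {i j} → i ≡ j → Child i j → Bounded knots (φ U V) g
  coincide {i} refl s = same-bounded n (child t i) 0<g
    (reduce (λ c → 3 * # i c + toℕ i) (toℕ i) (λ _ → refl) (λ _ → refl) refl refl s)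

  above : ∀ {i j} → toℕ j < toℕ i → ¬ Child i j
  above {i} {j} j<i s = <-irrefl (sym gap) (begin-strict
    7 ^ n * toℕ j + g₂          <⟨ +-monoʳ-< (7 ^ n * toℕ j) (Pos-< pos₂) ⟩
    7 ^ n * toℕ j + 7 ^ n       ≡⟨ +-comm (7 ^ n * toℕ j) (7 ^ n) ⟩
    7 ^ n + 7 ^ n * toℕ j       ≡⟨ *-suc (7 ^ n) (toℕ j) ⟨
    7 ^ n * suc (toℕ j)         ≤⟨ *-monoʳ-≤ (7 ^ n) j<i ⟩
    7 ^ n * toℕ i               ≤⟨ m≤n+m (7 ^ n * toℕ i) g ⟩
    g + 7 ^ n * toℕ i           ≤⟨ m≤m+n _ g₁ ⟩
    g + 7 ^ n * toℕ i + g₁      ∎)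
    where
    open ≤-Reasoning
    open State s

  adjacent : ∀ {i j} → toℕ j ≡ suc (toℕ i) → Child i j → Bounded knots (φ U V) g
  adjacent {i} {suc j} j≡ s = consecutive-bounded (toℕ-injective {i = i} {inject₁ j}
    (trans (sym (suc-injective j≡)) (sym (toℕ-inject₁ j)))) j≡ s
    where
    plus≡ : ∀ a b i → 3 * (a + b) + i ≡ 3 * a + (3 * b + i)
    plus≡ = solve-∀
    minus≡ : ∀ a i → a + suc i ≡ 1 + (a + i)
    minus≡ = solve-∀

    consecutive-bounded : ∀ {i} → i ≡ inject₁ j → toℕ (suc j) ≡ suc (toℕ i) → Child i (suc j) →
      Bounded knots (φ U V) g
    consecutive-bounded {i} refl j≡ s = next-bounded n (consecutive t j)
      (reduce (λ c → 3 * # i c + toℕ i) (toℕ i)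
        (λ c → trans (cong (λ x → 3 * x + toℕ i) (count-suc (children t) j c))
                     (plus≡ (axis (child t i) c) (# i c) (toℕ i)))
        (λ c → trans (cong (3 * # i c +_) j≡) (minus≡ (3 * # i c) (toℕ i)))
        refl j≡ s)

  cases : ∀ i j → Tri (toℕ i < toℕ j) (toℕ i ≡ toℕ j) (toℕ j < toℕ i) → Child i j → Bounded knots (φ U V) g
  cases i j (tri≈ _ i≡j _) s = coincide (toℕ-injective i≡j) s
  cases i j (tri> _ _ j<i) s = contradiction s (above j<i)
  cases i j (tri< i<j _ _) s =
    [ (λ s≤7 → adjacent (≤-antisym (near s≤7) i<j) s)
    , (λ 7<s → checkChild-sound depth t t (λ _ → 0) (λ _ → 0) i j (ok 7<s) (m<n⇒0<n∸m 7<s) (far 7<s) s)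
    ]′ (≤-<-connex (sep i j) 7)
    where
    ok : 7 < sep i j → T (checkChild depth t t (λ _ → 0) (λ _ → 0) (sep i j ∸ 7) i j)
    ok 7<s = [ (λ ≤7 → contradiction (≤ᵇ⇒≤ (sep i j) 7 ≤7) (<⇒≱ 7<s)) , id ]′
      (∨-elim {sep i j ≤ᵇ 7} (same-checked t i j))
    near : sep i j ≤ 7 → toℕ j ≤ suc (toℕ i)
    near s≤7 = +-cancelˡ-≤ 6 _ _ (subst₂ _≤_ (sep+ i j) (+-suc 6 (toℕ i)) (+-monoˡ-≤ (toℕ i) s≤7))
    far : 7 < sep i j → toℕ j ≡ toℕ i + suc (sep i j ∸ 7)
    far 7<s = +-cancelˡ-≡ 6 _ _ (begin
      6 + toℕ j                             ≡⟨ sep+ i j ⟨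
      sep i j + toℕ i                       ≡⟨ cong (_+ toℕ i) (m+[n∸m]≡n (<⇒≤ 7<s)) ⟨
      7 + (sep i j ∸ 7) + toℕ i             ≡⟨ shuffle (sep i j ∸ 7) (toℕ i) ⟩
      6 + (toℕ i + suc (sep i j ∸ 7))       ∎)
      where
      open ≡-Reasoning
      shuffle : ∀ a i → 7 + a + i ≡ 6 + (i + suc a)
      shuffle = solve-∀

-- The walk as a concatenation of blocks

α-involutive : ∀ s → α (α s) ≡ s
α-involutive 𝐢 = refl
α-involutive 𝐣 = refl
α-involutive 𝐤 = refl

β-involutive : ∀ s → β (β s) ≡ s
β-involutive 𝐢 = refl
β-involutive 𝐣 = refl
β-involutive 𝐤 = refl

braid : ∀ s → α (β (α s)) ≡ β (α (β s))
braid 𝐢 = refl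
braid 𝐣 = refl
braid 𝐤 = refl

act-·α : ∀ θ s → act (θ ·α) s ≡ act θ (α s)
act-·α 1ₚ   s = refl
act-·α αₚ   s = sym (α-involutive s)
act-·α βₚ   s = refl
act-·α αβₚ  s = refl
act-·α βαₚ  s = cong β (sym (α-involutive s))
act-·α αβαₚ s = cong (α ∘ β) (sym (α-involutive s))

act-·β : ∀ θ s → act (θ ·β) s ≡ act θ (β s)
act-·β 1ₚ   s = refl
act-·β αₚ   s = refl
act-·β βₚ   s = sym (β-involutive s)
act-·β αβₚ  s = cong α (sym (β-involutive s))
act-·β βαₚ  s = braid s
act-·β αβαₚ s = trans (cong (β ∘ α) (sym (β-involutive s))) (sym (braid (β s)))

word : ℕ → Block → List Step
word n (θ , false) = map (act θ) (A n)
word n (θ , true)  = reverse (map (act θ) (A n))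

words : ∀ {m} → ℕ → Vec Block m → List Step
words n []       = []
words n (t ∷ ts) = word n t ++ words n ts

reverse-concat : ∀ (xss : List (List Step)) →
  reverse (concat xss) ≡ concat (reverse (map reverse xss))
reverse-concat []         = refl
reverse-concat (xs ∷ xss) = begin
  reverse (xs ++ concat xss)                              ≡⟨ reverse-++ xs (concat xss) ⟩
  reverse (concat xss) ++ reverse xs                      ≡⟨ cong₂ _++_ (reverse-concat xss) (sym (++-identityʳ (reverse xs))) ⟩
  concat (reverse (map reverse xss)) ++ concat [ reverse xs ] ≡⟨ concat-++ (reverse (map reverse xss)) [ reverse xs ] ⟩
  concat (reverse (map reverse xss) ++ [ reverse xs ])    ≡⟨ cong concat (unfold-reverse (reverse xs) (map reverse xss)) ⟨
  concat (reverse (reverse xs ∷ map reverse xss))         ∎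
  where open ≡-Reasoning

word-suc : ∀ n t → word (suc n) t ≡ words n (children t)
word-suc n (θ , false) = begin
  map (act θ) (A (suc n))
    ≡⟨ cong (λ x → map (act θ) (a ++ map α a ++ reverse (map β a) ++ a ++
         reverse (map β (map α a)) ++ reverse (map β a) ++ x)) (sym (++-identityʳ a)) ⟩
  map (act θ) (concat pieces)                   ≡⟨ concat-map pieces ⟨
  concat (map (map (act θ)) pieces)
    ≡⟨ cong₂ (λ x y → map (act θ) a ++ x ++ y) image-α
        (cong₂ (λ x y → x ++ map (act θ) a ++ y) image-β
          (cong₂ (λ x y → x ++ y ++ map (act θ) a ++ []) image-βα image-β)) ⟩
  words n (children (θ , false))                ∎
  where
  open ≡-Reasoning
  a = A n
  pieces = a ∷ map α a ∷ reverse (map β a) ∷ a ∷ reverse (map β (map α a)) ∷ reverse (map β a) ∷ a ∷ []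

  map-α : ∀ θ xs → map (act θ) (map α xs) ≡ map (act (θ ·α)) xs
  map-α θ xs = trans (sym (map-∘ xs)) (sym (map-cong (act-·α θ) xs))

  map-β : ∀ θ xs → map (act θ) (map β xs) ≡ map (act (θ ·β)) xs
  map-β θ xs = trans (sym (map-∘ xs)) (sym (map-cong (act-·β θ) xs))

  image-α : map (act θ) (map α a) ≡ word n (θ ·α , false)
  image-α = map-α θ a

  image-β : map (act θ) (reverse (map β a)) ≡ word n (θ ·β , true)
  image-β = trans (reverse-map (act θ) (map β a)) (cong reverse (map-β θ a))

  image-βα : map (act θ) (reverse (map β (map α a))) ≡ word n (θ ·β ·α , true)
  image-βα = trans (reverse-map (act θ) (map β (map α a)))
    (cong reverse (trans (map-β θ (map α a)) (map-α (θ ·β) a)))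
word-suc n (θ , true) = begin
  reverse (word (suc n) (θ , false))            ≡⟨ cong reverse (word-suc n (θ , false)) ⟩
  reverse (concat ws)                           ≡⟨ reverse-concat ws ⟩
  concat (reverse (map reverse ws))
    ≡⟨ cong₂ (λ x y → word n (θ , true) ++ x ++ y) (reverse-involutive (map (act (θ ·β)) a))
         (cong₂ (λ x y → x ++ word n (θ , true) ++ y) (reverse-involutive (map (act (θ ·β ·α)) a))
           (cong (_++ word n (θ ·α , true) ++ word n (θ , true) ++ []) (reverse-involutive (map (act (θ ·β)) a)))) ⟩
  words n (children (θ , true))                 ∎
  where
  open ≡-Reasoning
  a = A n
  ws = word n (θ , false) ∷ word n (θ ·α , false) ∷ word n (θ ·β , true) ∷ word n (θ , false) ∷
       word n (θ ·β ·α , true) ∷ word n (θ ·β , true) ∷ word n (θ , false) ∷ []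

length-word : ∀ n t → length (word n t) ≡ 7 ^ n
length-word n (θ , false) = trans (length-map (act θ) (A n)) (length-A n)
length-word n (θ , true)  = trans (length-reverse (word n (θ , false))) (length-word n (θ , false))

occ : Step → List Step → ℕ
occ c []       = 0
occ c (x ∷ xs) = match x c + occ c xs

occ-++ : ∀ c xs ys → occ c (xs ++ ys) ≡ occ c xs + occ c ys
occ-++ c []       ys = refl
occ-++ c (x ∷ xs) ys = trans (cong (match x c +_) (occ-++ c xs ys)) (sym (+-assoc (match x c) _ _))

total : ∀ {m} → Vec Block m → Step → ℕ
total []       c = 0
total (t ∷ ts) c = axis t c + total ts c

-- The origin of the factor 4: with a = `axis t c`, the children contribute 3 (1 + 4 a) - 7 = 4 (3 a
-- - 1) to the projection.
total-children : ∀ t c → total (children t) c ≡ 1 + 4 * axis t c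
total-children t c = ≡ᵇ⇒≡ _ (1 + 4 * axis t c) (everyStep-sound (λ c → total (children t) c ≡ᵇ 1 + 4 * axis t c)
  (everyBlock-sound (λ t → everyStep λ c → total (children t) c ≡ᵇ 1 + 4 * axis t c) refl t) c)

occ-word : ∀ n t c → 3 * occ c (word n t) + 4 ^ n ≡ 7 ^ n + 4 ^ n * (3 * axis t c)
occ-words : ∀ n {m} (ts : Vec Block m) c →
  3 * occ c (words n ts) + 4 ^ n * m ≡ 7 ^ n * m + 4 ^ n * (3 * total ts c)

occ-word zero    (θ , false) c = unit (match (act θ 𝐢) c)
  where
  unit : ∀ x → 3 * (x + 0) + 1 ≡ 1 + 1 * (3 * x)
  unit = solve-∀
occ-word zero    (θ , true) c = occ-word zero (θ , false) c
occ-word (suc n) t c = +-cancelʳ-≡ (3 * 4 ^ n) _ _ (begin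
  3 * occ c (word (suc n) t) + 4 * 4 ^ n + 3 * 4 ^ n
    ≡⟨ left (3 * occ c (word (suc n) t)) (4 ^ n) ⟩
  3 * occ c (word (suc n) t) + 4 ^ n * 7
    ≡⟨ cong (λ w → 3 * occ c w + 4 ^ n * 7) (word-suc n t) ⟩
  3 * occ c (words n (children t)) + 4 ^ n * 7
    ≡⟨ occ-words n (children t) c ⟩
  7 ^ n * 7 + 4 ^ n * (3 * total (children t) c)
    ≡⟨ cong (λ x → 7 ^ n * 7 + 4 ^ n * (3 * x)) (total-children t c) ⟩
  7 ^ n * 7 + 4 ^ n * (3 * (1 + 4 * axis t c))
    ≡⟨ right (7 ^ n) (4 ^ n) (axis t c) ⟩
  7 * 7 ^ n + 4 * 4 ^ n * (3 * axis t c) + 3 * 4 ^ n ∎)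
  where
  open ≡-Reasoning
  left : ∀ a k → a + 4 * k + 3 * k ≡ a + k * 7
  left = solve-∀
  right : ∀ l k x → l * 7 + k * (3 * (1 + 4 * x)) ≡ 7 * l + 4 * k * (3 * x) + 3 * k
  right = solve-∀

occ-words n []               c = base (7 ^ n) (4 ^ n)
  where
  base : ∀ l k → k * 0 ≡ l * 0 + k * 0
  base = solve-∀
occ-words n {suc m} (t ∷ ts) c = begin
  3 * occ c (word n t ++ words n ts) + 4 ^ n * suc m
    ≡⟨ cong (λ x → 3 * x + 4 ^ n * suc m) (occ-++ c (word n t) (words n ts)) ⟩
  3 * (occ c (word n t) + occ c (words n ts)) + 4 ^ n * suc m
    ≡⟨ left (occ c (word n t)) (occ c (words n ts)) (4 ^ n) m ⟩
  (3 * occ c (word n t) + 4 ^ n) + (3 * occ c (words n ts) + 4 ^ n * m)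
    ≡⟨ cong₂ _+_ (occ-word n t c) (occ-words n ts c) ⟩
  (7 ^ n + 4 ^ n * (3 * axis t c)) + (7 ^ n * m + 4 ^ n * (3 * total ts c))
    ≡⟨ right (7 ^ n) (4 ^ n) (axis t c) m (total ts c) ⟩
  7 ^ n * suc m + 4 ^ n * (3 * (axis t c + total ts c)) ∎
  where
  open ≡-Reasoning
  left : ∀ a b k m → 3 * (a + b) + k * suc m ≡ (3 * a + k) + (3 * b + k * m)
  left = solve-∀
  right : ∀ l k x m y → (l + k * (3 * x)) + (l * m + k * (3 * y)) ≡ l * suc m + k * (3 * (x + y))
  right = solve-∀

take-++-≤ : ∀ p (xs ys : List Step) → p ≤ length xs → take p (xs ++ ys) ≡ take p xs
take-++-≤ zero    xs       ys _         = refl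
take-++-≤ (suc p) (x ∷ xs) ys (s≤s p≤) = cong (x ∷_) (take-++-≤ p xs ys p≤)

take-++-+ : ∀ (xs ys : List Step) q → take (length xs + q) (xs ++ ys) ≡ xs ++ take q ys
take-++-+ []       ys q = refl
take-++-+ (x ∷ xs) ys q = cong (x ∷_) (take-++-+ xs ys q)

locate : ∀ n {m} (ts : Vec Block m) p → p < 7 ^ n * m →
  ∃₂ λ i p′ → p′ < 7 ^ n × p ≡ 7 ^ n * toℕ i + p′ ×
    (∀ c → 3 * occ c (take p (words n ts)) + 4 ^ n * toℕ i ≡
           7 ^ n * toℕ i + 4 ^ n * (3 * count ts i c) + 3 * occ c (take p′ (word n (lookup ts i))))
locate n [] p p< = contradiction (subst (p <_) (*-zeroʳ (7 ^ n)) p<) (λ ())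
locate n {suc m} (t ∷ ts) p p< with p <? 7 ^ n
... | yes p<w = zero , p , p<w , cong (_+ p) (sym (*-zeroʳ (7 ^ n))) , λ c → begin
  3 * occ c (take p (word n t ++ words n ts)) + 4 ^ n * 0
    ≡⟨ cong (λ w → 3 * occ c w + 4 ^ n * 0)
         (take-++-≤ p (word n t) (words n ts) (subst (p ≤_) (sym (length-word n t)) (<⇒≤ p<w))) ⟩
  3 * occ c (take p (word n t)) + 4 ^ n * 0
    ≡⟨ base (3 * occ c (take p (word n t))) (7 ^ n) (4 ^ n) ⟩
  7 ^ n * 0 + 4 ^ n * (3 * 0) + 3 * occ c (take p (word n t)) ∎
  where
  open ≡-Reasoning
  base : ∀ a l k → a + k * 0 ≡ l * 0 + k * (3 * 0) + a
  base = solve-∀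
... | no p≮w = let
    q = p ∸ 7 ^ n
    p≡ = sym (m+[n∸m]≡n (≮⇒≥ p≮w))
    i , p′ , p′< , q≡ , eq = locate n ts q
      (+-cancelˡ-< (7 ^ n) q (7 ^ n * m) (subst₂ _<_ p≡ (*-suc (7 ^ n) m) p<))
  in suc i , p′ , p′< ,
  trans p≡ (trans (cong (7 ^ n +_) q≡)
    (trans (sym (+-assoc (7 ^ n) (7 ^ n * toℕ i) p′)) (cong (_+ p′) (sym (*-suc (7 ^ n) (toℕ i)))))) ,
  λ c → begin
  3 * occ c (take p (word n t ++ words n ts)) + 4 ^ n * suc (toℕ i)
    ≡⟨ cong (λ r → 3 * occ c (take r (word n t ++ words n ts)) + 4 ^ n * suc (toℕ i))
         (trans p≡ (cong (_+ q) (sym (length-word n t)))) ⟩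
  3 * occ c (take (length (word n t) + q) (word n t ++ words n ts)) + 4 ^ n * suc (toℕ i)
    ≡⟨ cong (λ w → 3 * w + 4 ^ n * suc (toℕ i))
         (trans (cong (occ c) (take-++-+ (word n t) (words n ts) q)) (occ-++ c (word n t) (take q (words n ts)))) ⟩
  3 * (occ c (word n t) + occ c (take q (words n ts))) + 4 ^ n * suc (toℕ i)
    ≡⟨ left (occ c (word n t)) (occ c (take q (words n ts))) (4 ^ n) (toℕ i) ⟩
  (3 * occ c (word n t) + 4 ^ n) + (3 * occ c (take q (words n ts)) + 4 ^ n * toℕ i)
    ≡⟨ cong₂ _+_ (occ-word n t c) (eq c) ⟩
  (7 ^ n + 4 ^ n * (3 * axis t c)) +
  (7 ^ n * toℕ i + 4 ^ n * (3 * count ts i c) + 3 * occ c (take p′ (word n (lookup ts i))))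
    ≡⟨ right (7 ^ n) (4 ^ n) (axis t c) (toℕ i) (count ts i c) (3 * occ c (take p′ (word n (lookup ts i)))) ⟩
  7 ^ n * suc (toℕ i) + 4 ^ n * (3 * (axis t c + count ts i c)) + 3 * occ c (take p′ (word n (lookup ts i))) ∎
  where
  open ≡-Reasoning
  left : ∀ a b k m → 3 * (a + b) + k * suc m ≡ (3 * a + k) + (3 * b + k * m)
  left = solve-∀
  right : ∀ l k x m y z → (l + k * (3 * x)) + (l * m + k * (3 * y) + z) ≡ l * suc m + k * (3 * (x + y)) + z
  right = solve-∀

position : ∀ n t p → p < 7 ^ n → Pos n t p (λ c → occ c (take p (word n t)))
position zero    t zero    _         = origin (λ _ → refl)
position zero    t (suc p) (s≤s ())
position (suc n) t p p<
  with i , p′ , p′< , p≡ , eq ← locate n (children t) p (subst (p <_) (*-comm 7 (7 ^ n)) p<) =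
  inside i (position n (child t i) p′ p′<) p≡
    (λ c → trans (cong (λ w → 3 * occ c (take p w) + 4 ^ n * toℕ i) (word-suc n t)) (eq c))

visits : ℕ → Step → ℕ
visits p c = occ c (applyUpTo v p)

take-applyUpTo : ∀ (f : ℕ → Step) {p n} → p ≤ n → take p (applyUpTo f n) ≡ applyUpTo f p
take-applyUpTo f z≤n       = refl
take-applyUpTo f (s≤s p≤n) = cong (f 0 ∷_) (take-applyUpTo (f ∘ suc) p≤n)

walk-position : ∀ n p → p < 7 ^ n → Pos n (1ₚ , false) p (visits p)
walk-position n p p< = subst (λ w → Pos n (1ₚ , false) p (λ c → occ c w))
  (begin
    take p (map id (A n))               ≡⟨ cong (take p) (map-id (A n)) ⟩
    take p (A n)                        ≡⟨ cong (take p) (v-prefix n) ⟨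
    take p (applyUpTo v (7 ^ n))        ≡⟨ take-applyUpTo v (<⇒≤ p<) ⟩
    applyUpTo v p                       ∎)
  (position n (1ₚ , false) p p<)
  where open ≡-Reasoning

-- The projection 3 (x_q - x_p) - (q - p) is the difference ahead - behind.
ahead behind : ℕ → ℕ → Step → ℕ
ahead  p q c = 3 * visits q c + p
behind p q c = 3 * visits p c + q

-- As q < 7^q, both points are positions of the single block of level `q` at the start of the walk,
-- and all offsets are zero.
walk-bounded : ∀ {p q} → p < q → Bounded knots (φ (ahead p q) (behind p q)) (q ∸ p)
walk-bounded {p} {q} p<q = same-bounded q (1ₚ , false) {ahead p q} {behind p q} {q ∸ p} (m<n⇒0<n∸m p<q)
  (state (walk-position q p (<-trans p<q (n<7^n q))) (walk-position q q (n<7^n q))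
    (λ c → shift (4 ^ q) (3 * visits p c) (3 * visits q c) p q)
    (gap (7 ^ q) {q ∸ p} (trans (+-comm (q ∸ p) p) (m+[n∸m]≡n (<⇒≤ p<q)))))
  where
  shift : ∀ k x y p q → (y + p) + k * 0 + (x + q) ≡ (x + q) + k * 0 + (y + p)
  shift = solve-∀
  zeroes : ∀ k g p → g + k * 0 + p ≡ g + p
  zeroes = solve-∀
  gap : ∀ k {g p q} → g + p ≡ q → g + k * 0 + p ≡ k * 0 + q
  gap k {g} {p} {q} eq = trans (zeroes k g p) (trans eq (sym (zeroes k 0 q)))

-- Collinear lattice points

toℚ : ℤ → ℚ
toℚ i = i ℚ./ 1

private
  -- Division normalises through a gcd and is stuck on a variable; the explicit form computes.
  toℚ-mkℚ : ∀ i → toℚ i ≡ mkℚ i 0 (Coprime.sym (1-coprimeTo ℤ.∣ i ∣))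
  toℚ-mkℚ i = ℚ.↥p/↧p≡p (mkℚ i 0 (Coprime.sym (1-coprimeTo ℤ.∣ i ∣)))

toℚ-injective : ∀ {i j} → toℚ i ≡ toℚ j → i ≡ j
toℚ-injective {i} {j} eq = cong ℚ.↥_ (trans (sym (toℚ-mkℚ i)) (trans eq (toℚ-mkℚ j)))

toℚ-+ : ∀ i j → toℚ (i ℤ.+ j) ≡ toℚ i ℚ.+ toℚ j
toℚ-+ i j = sym (trans (cong₂ ℚ._+_ (toℚ-mkℚ i) (toℚ-mkℚ j))
  (cong toℚ (cong₂ ℤ._+_ (ℤ.*-identityʳ i) (ℤ.*-identityʳ j))))

toℚ-* : ∀ i j → toℚ (i ℤ.* j) ≡ toℚ i ℚ.* toℚ j
toℚ-* i j = sym (cong₂ ℚ._*_ (toℚ-mkℚ i) (toℚ-mkℚ j))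

toℚ-neg : ∀ i → toℚ (ℤ.- i) ≡ ℚ.- toℚ i
toℚ-neg ℤ.-[1+ n ] = sym (⁻¹-involutive (toℚ ℤ.+[1+ n ]))
toℚ-neg ℤ.+0       = refl
toℚ-neg ℤ.+[1+ n ] = refl

toℚ-− : ∀ i j → toℚ (i ℤ.- j) ≡ toℚ i ℚ.- toℚ j
toℚ-− i j = trans (toℚ-+ i (ℤ.- j)) (cong (toℚ i ℚ.+_) (toℚ-neg j))

Null : (ℕ → ℚ) → Set
Null x = ∀ ε → 0ℚ ℚ.< ε → ∃[ N ] (∀ n → N ℕ.≤ n → ℚ.∣ x n ∣ ℚ.< ε)

Eventually-bounded : (ℕ → ℚ) → Set
Eventually-bounded x = ∃[ K ] 0ℚ ℚ.< K × ∃[ N ] (∀ n → N ℕ.≤ n → ℚ.∣ x n ∣ ℚ.≤ K)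

Null-resp : ∀ {x y} → (∀ n → x n ≡ y n) → Null x → Null y
Null-resp x≡y null ε 0<ε with N , bound ← null ε 0<ε =
  N , λ n n≥ → subst (λ q → ℚ.∣ q ∣ ℚ.< ε) (x≡y n) (bound n n≥)

Null-+ : ∀ {x y} → Null x → Null y → Null (λ n → x n ℚ.+ y n)
Null-+ {x} {y} null-x null-y ε 0<ε = M ⊔ N , bound
  where
  0<½ε : 0ℚ ℚ.< ½ ℚ.* ε
  0<½ε = subst (ℚ._< ½ ℚ.* ε) (ℚ.*-zeroʳ ½) (ℚ.*-monoʳ-<-pos ½ 0<ε)
  M = proj₁ (null-x (½ ℚ.* ε) 0<½ε)
  N = proj₁ (null-y (½ ℚ.* ε) 0<½ε)
  x< = proj₂ (null-x (½ ℚ.* ε) 0<½ε)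
  y< = proj₂ (null-y (½ ℚ.* ε) 0<½ε)
  bound : ∀ n → M ⊔ N ℕ.≤ n → ℚ.∣ x n ℚ.+ y n ∣ ℚ.< ε
  bound n n≥ = begin-strict
    ℚ.∣ x n ℚ.+ y n ∣               ≤⟨ ℚ.∣p+q∣≤∣p∣+∣q∣ (x n) (y n) ⟩
    ℚ.∣ x n ∣ ℚ.+ ℚ.∣ y n ∣         <⟨ ℚ.+-mono-< (x< n (ℕ.m⊔n≤o⇒m≤o M N n≥)) (y< n (ℕ.m⊔n≤o⇒n≤o M N n≥)) ⟩
    ½ ℚ.* ε ℚ.+ ½ ℚ.* ε             ≡⟨ ℚ.*-distribʳ-+ ε ½ ½ ⟨
    1ℚ ℚ.* ε                        ≡⟨ ℚ.*-identityˡ ε ⟩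
    ε                               ∎
    where open ℚ.≤-Reasoning

Null-neg : ∀ {x} → Null x → Null (λ n → ℚ.- x n)
Null-neg {x} null ε 0<ε with N , bound ← null ε 0<ε =
  N , λ n n≥ → subst (ℚ._< ε) (sym (ℚ.∣-p∣≡∣p∣ (x n))) (bound n n≥)

Null-* : ∀ {x y} → Null x → Eventually-bounded y → Null (λ n → x n ℚ.* y n)
Null-* {x} {y} null (K , 0<K , M , y≤K) ε 0<ε = M ⊔ N , bound
  where
  instance
    K>0 = ℚ.positive 0<K
    K≢0 = ℚ.pos⇒nonZero K
    1/K>0 = ℚ.1/pos⇒pos K
  δ = (ℚ.1/ K) ℚ.* ε
  0<δ : 0ℚ ℚ.< δ
  0<δ = subst (ℚ._< δ) (ℚ.*-zeroʳ (ℚ.1/ K)) (ℚ.*-monoʳ-<-pos (ℚ.1/ K) 0<ε)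
  N = proj₁ (null δ 0<δ)
  bound : ∀ n → M ⊔ N ℕ.≤ n → ℚ.∣ x n ℚ.* y n ∣ ℚ.< ε
  bound n n≥ = begin-strict
    ℚ.∣ x n ℚ.* y n ∣            ≡⟨ ℚ.∣p*q∣≡∣p∣*∣q∣ (x n) (y n) ⟩
    ℚ.∣ x n ∣ ℚ.* ℚ.∣ y n ∣      ≤⟨ ℚ.*-monoˡ-≤-nonNeg ℚ.∣ x n ∣ {{ℚ.nonNegative (ℚ.0≤∣p∣ (x n))}}
                                      (y≤K n (ℕ.m⊔n≤o⇒m≤o M N n≥)) ⟩
    ℚ.∣ x n ∣ ℚ.* K              <⟨ ℚ.*-monoˡ-<-pos K (proj₂ (null δ 0<δ) n (ℕ.m⊔n≤o⇒n≤o M N n≥)) ⟩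
    δ ℚ.* K                      ≡⟨ ℚ.*-comm δ K ⟩
    K ℚ.* δ                      ≡⟨ ℚ.*-assoc K (ℚ.1/ K) ε ⟨
    (K ℚ.* (ℚ.1/ K)) ℚ.* ε       ≡⟨ cong (ℚ._* ε) (ℚ.*-inverseʳ K) ⟩
    1ℚ ℚ.* ε                     ≡⟨ ℚ.*-identityˡ ε ⟩
    ε                            ∎
    where open ℚ.≤-Reasoning

private
  0<1 : 0ℚ ℚ.< 1ℚ
  0<1 = ℚ.positive⁻¹ 1ℚ

Null⇒bounded : ∀ {x} → Null x → Eventually-bounded x
Null⇒bounded null with N , bound ← null 1ℚ 0<1 = 1ℚ , 0<1 , N , λ n n≥ → ℚ.<⇒≤ (bound n n≥)

constant-bounded : ∀ q → Eventually-bounded (λ _ → q)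
constant-bounded q = 1ℚ ℚ.+ ℚ.∣ q ∣ , ℚ.+-mono-<-≤ 0<1 (ℚ.0≤∣p∣ q) , 0 , λ _ _ →
  subst (ℚ._≤ 1ℚ ℚ.+ ℚ.∣ q ∣) (ℚ.+-identityˡ ℚ.∣ q ∣) (ℚ.+-monoˡ-≤ ℚ.∣ q ∣ (ℚ.<⇒≤ 0<1))

Null-constant : ∀ q → Null (λ _ → q) → q ≡ 0ℚ
Null-constant q null with q ℚ.≟ 0ℚ
... | yes q≡0 = q≡0
... | no  q≢0 with N , bound ← null ℚ.∣ q ∣ (ℚ.≰⇒> (λ q≤0 → q≢0 (ℚ.∣p∣≡0⇒p≡0 q (ℚ.≤-antisym q≤0 (ℚ.0≤∣p∣ q))))) =
  contradiction (bound N ℕ.≤-refl) (ℚ.<-irrefl refl)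

infix 4 _⟵_

-- A record, so that limit and sequence can be inferred from the type; they could not be read off
-- `Null` of their difference.
record _⟵_ (q : ℚ) (x : ℕ → ℚ) : Set where
  constructor converges
  field error : Null (λ n → q ℚ.- x n)

open _⟵_

module _ {p q : ℚ} {x y : ℕ → ℚ} (p⟵x : p ⟵ x) (q⟵y : q ⟵ y) where
  open +-*-Solver

  ⟵-− : p ℚ.- q ⟵ (λ n → x n ℚ.- y n)
  ⟵-− = converges (Null-resp (λ n → identity p q (x n) (y n)) (Null-+ (error p⟵x) (Null-neg (error q⟵y))))
    where
    identity : ∀ p q x y → (p ℚ.- x) ℚ.+ (ℚ.- (q ℚ.- y)) ≡ (p ℚ.- q) ℚ.- (x ℚ.- y)
    identity = solve 4 (λ p q x y → (p :- x) :+ (:- (q :- y)) := (p :- q) :- (x :- y)) refl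

  -- The error is expanded around the limits, so that only constants and null sequences have to be
  -- bounded.
  ⟵-* : p ℚ.* q ⟵ (λ n → x n ℚ.* y n)
  ⟵-* = converges (Null-resp (λ n → identity p q (x n) (y n))
    (Null-+ (Null-+ (Null-* (error p⟵x) (constant-bounded q)) (Null-* (error q⟵y) (constant-bounded p)))
            (Null-neg (Null-* (error p⟵x) (Null⇒bounded (error q⟵y))))))
    where
    identity : ∀ p q x y →
      ((p ℚ.- x) ℚ.* q ℚ.+ (q ℚ.- y) ℚ.* p) ℚ.+ (ℚ.- ((p ℚ.- x) ℚ.* (q ℚ.- y))) ≡ p ℚ.* q ℚ.- x ℚ.* y
    identity = solve 4 (λ p q x y →
      ((p :- x) :* q :+ (q :- y) :* p) :+ (:- ((p :- x) :* (q :- y))) := p :* q :- x :* y) refl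

  ⟵-unique : (∀ n → x n ≡ y n) → p ≡ q
  ⟵-unique x≡y = begin
    p                  ≡⟨ identity p q ⟩
    (p ℚ.- q) ℚ.+ q    ≡⟨ cong (ℚ._+ q) (Null-constant (p ℚ.- q) (Null-resp cancel (error ⟵-−))) ⟩
    0ℚ ℚ.+ q           ≡⟨ ℚ.+-identityˡ q ⟩
    q                  ∎
    where
    open ≡-Reasoning
    identity : ∀ p q → p ≡ (p ℚ.- q) ℚ.+ q
    identity = solve 2 (λ p q → p := (p :- q) :+ q) refl
    cancel′ : ∀ p q x → (p ℚ.- q) ℚ.- (x ℚ.- x) ≡ p ℚ.- q
    cancel′ = solve 3 (λ p q x → (p :- q) :- (x :- x) := p :- q) refl
    cancel : ∀ n → (p ℚ.- q) ℚ.- (x n ℚ.- y n) ≡ p ℚ.- q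
    cancel n = trans (cong (λ z → (p ℚ.- q) ℚ.- (x n ℚ.- z)) (sym (x≡y n))) (cancel′ p q (x n))

module _ (L : Line) where
  open Line L

  on : ℝ → Fin 3 → ℕ → ℚ
  on t i n = seq (lookup base i) n ℚ.+ seq t n ℚ.* seq (lookup direction i) n

  ∈ℓ⇒⟵ : ∀ {P} ((t , _) : ι P ∈ℓ L) i → toℚ (lookup P i) ⟵ on t i
  ∈ℓ⇒⟵ {P} (t , P≃) i = converges (subst₂ _≃_ (lookup-map i fromℤ P)
    (trans (lookup-zipWith _+ℝ_ i base (Vec.map (t *ℝ_) direction))
           (cong (lookup base i +ℝ_) (lookup-map i (t *ℝ_) direction)))
    (Pointwise.lookup P≃ i))

  -- In differences the base cancels, and both products become the same product of two parameter
  -- differences and two direction coordinates. This is a polynomial identity at each index of the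
  -- approximating sequences, and rational limits are unique.
  collinear : ∀ {P Q R S} → ι P ∈ℓ L → ι Q ∈ℓ L → ι R ∈ℓ L → ι S ∈ℓ L → ∀ i j →
    (lookup P i ℤ.- lookup Q i) ℤ.* (lookup R j ℤ.- lookup S j) ≡
    (lookup R i ℤ.- lookup S i) ℤ.* (lookup P j ℤ.- lookup Q j)
  collinear {P} {Q} {R} {S} p q r s i j = toℚ-injective (begin
    toℚ ((lookup P i ℤ.- lookup Q i) ℤ.* (lookup R j ℤ.- lookup S j))
      ≡⟨ push (lookup P i) (lookup Q i) (lookup R j) (lookup S j) ⟩
    (toℚ (lookup P i) ℚ.- toℚ (lookup Q i)) ℚ.* (toℚ (lookup R j) ℚ.- toℚ (lookup S j))
      ≡⟨ ⟵-unique (⟵-* (⟵-− (∈ℓ⇒⟵ {P} p i) (∈ℓ⇒⟵ {Q} q i)) (⟵-− (∈ℓ⇒⟵ {R} r j) (∈ℓ⇒⟵ {S} s j)))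
                   (⟵-* (⟵-− (∈ℓ⇒⟵ {R} r i) (∈ℓ⇒⟵ {S} s i)) (⟵-− (∈ℓ⇒⟵ {P} p j) (∈ℓ⇒⟵ {Q} q j)))
                   (λ n → swap (seq (lookup base i) n) (seq (lookup direction i) n)
                               (seq (lookup base j) n) (seq (lookup direction j) n)
                               (seq (proj₁ p) n) (seq (proj₁ q) n) (seq (proj₁ r) n) (seq (proj₁ s) n)) ⟩
    (toℚ (lookup R i) ℚ.- toℚ (lookup S i)) ℚ.* (toℚ (lookup P j) ℚ.- toℚ (lookup Q j))
      ≡⟨ push (lookup R i) (lookup S i) (lookup P j) (lookup Q j) ⟨
    toℚ ((lookup R i ℤ.- lookup S i) ℤ.* (lookup P j ℤ.- lookup Q j)) ∎)
    where
    open ≡-Reasoning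
    open +-*-Solver
    push : ∀ a b c d → toℚ ((a ℤ.- b) ℤ.* (c ℤ.- d)) ≡ (toℚ a ℚ.- toℚ b) ℚ.* (toℚ c ℚ.- toℚ d)
    push a b c d = trans (toℚ-* (a ℤ.- b) (c ℤ.- d)) (cong₂ ℚ._*_ (toℚ-− a b) (toℚ-− c d))
    swap : ∀ b d b′ d′ p q r s →
      ((b ℚ.+ p ℚ.* d) ℚ.- (b ℚ.+ q ℚ.* d)) ℚ.* ((b′ ℚ.+ r ℚ.* d′) ℚ.- (b′ ℚ.+ s ℚ.* d′)) ≡
      ((b ℚ.+ r ℚ.* d) ℚ.- (b ℚ.+ s ℚ.* d)) ℚ.* ((b′ ℚ.+ p ℚ.* d′) ℚ.- (b′ ℚ.+ q ℚ.* d′))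
    swap = solve 8 (λ b d b′ d′ p q r s →
      ((b :+ p :* d) :- (b :+ q :* d)) :* ((b′ :+ r :* d′) :- (b′ :+ s :* d′)) :=
      ((b :+ r :* d) :- (b :+ s :* d)) :* ((b′ :+ p :* d′) :- (b′ :+ q :* d′))) refl

-- Comparing slopes

4^≤7^ : ∀ s → 4 ^ s ≤ 7 ^ s
4^≤7^ s = ^-monoˡ-≤ s {4} {7} (m≤m+n 4 3)

-- Here `k` holds a short gap g at scale a, and `l` a gap D ≥ 188 g at scale b. The three components
-- treat b - a = 2, 3 and at least 4, with the powers of 7 and 4 to match. In the first two, either
-- no such g and D fit the knots or the slope bounds are disjoint; in the last the bounds are always
-- disjoint.
Steep : Knot → Knot → Set
Steep k l = (to l * 49 ≤ 188 * from k ⊎ upper l * 16 < lower k * 49) ×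
            (to l * 343 ≤ 188 * from k ⊎ upper l * 64 < lower k * 343) ×
            upper l * 256 < lower k * 2401

steep : ∀ {k l} → k ∈ knots → l ∈ knots → Steep k l
steep k∈ l∈ = All.lookup (All.lookup (from-yes (All.all? (λ k → All.all? (λ l →
  ((to l * 49 ≤? 188 * from k) ⊎-dec (upper l * 16 <? lower k * 49)) ×-dec
  ((to l * 343 ≤? 188 * from k) ⊎-dec (upper l * 64 <? lower k * 343)) ×-dec
  (upper l * 256 <? lower k * 2401)) knots) knots)) k∈) l∈

steeper : ∀ {k l} → Steep k l → ∀ s → 188 * from k < to l * (49 * 7 ^ s) →
          upper l * (16 * 4 ^ s) < lower k * (49 * 7 ^ s)
steeper (inj₁ ≤k , _) 0 k< = contradiction k< (≤⇒≯ ≤k)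
steeper (inj₂ u< , _) 0 k< = u<
steeper (_ , inj₁ ≤k , _) 1 k< = contradiction k< (≤⇒≯ ≤k)
steeper (_ , inj₂ u< , _) 1 k< = u<
steeper {k} {l} (_ , _ , u<) (suc (suc s)) k< = begin-strict
  upper l * (16 * (4 * (4 * 4 ^ s)))    ≡⟨ left (upper l) (4 ^ s) ⟩
  upper l * 256 * 4 ^ s                 ≤⟨ *-monoʳ-≤ (upper l * 256) (4^≤7^ s) ⟩
  upper l * 256 * 7 ^ s                 <⟨ *-monoˡ-< (7 ^ s) {{m^n≢0 7 s}} u< ⟩
  lower k * 2401 * 7 ^ s                ≡⟨ right (lower k) (7 ^ s) ⟨
  lower k * (49 * (7 * (7 * 7 ^ s)))    ∎
  where
  open ≤-Reasoning
  left : ∀ u x → u * (16 * (4 * (4 * x))) ≡ u * 256 * x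
  left = solve-∀
  right : ∀ u x → u * (49 * (7 * (7 * x))) ≡ u * 2401 * x
  right = solve-∀

slope-drops : ∀ {k l a b g D} → k ∈ knots → l ∈ knots →
  from k * 7 ^ a ≤ 100 * g → 100 * D < to l * 7 ^ b → 188 * g ≤ D →
  upper l * (4 ^ b * 7 ^ a) < lower k * (4 ^ a * 7 ^ b)
slope-drops {k} {l} {a} {b} {g} {D} k∈ l∈ k≤ <l far = conclude (m≤n⇒∃[o]m+o≡n level)
  where
  open ≤-Reasoning
  swap : ∀ x y z → x * (y * z) ≡ y * (x * z)
  swap = solve-∀

  apart : 188 * (from k * 7 ^ a) < to l * 7 ^ b
  apart = begin-strict
    188 * (from k * 7 ^ a)   ≤⟨ *-monoʳ-≤ 188 k≤ ⟩
    188 * (100 * g)          ≡⟨ swap 188 100 g ⟩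
    100 * (188 * g)          ≤⟨ *-monoʳ-≤ 100 far ⟩
    100 * D                  <⟨ <l ⟩
    to l * 7 ^ b             ∎

  sevens : ∀ x → 700 * (7 * x) ≡ 100 * (49 * x)
  sevens = solve-∀

  -- If b ≤ a + 1, then D < 49 · 7ᵃ ≤ 188 · 7ᵃ ≤ 188 g.
  level : 2 + a ≤ b
  level with 2 + a ≤? b
  ... | yes p = p
  ... | no ¬p = contradiction apart (≤⇒≯ (begin
    to l * 7 ^ b               ≤⟨ *-mono-≤ (proj₂ (knot-range l∈)) (^-monoʳ-≤ 7 (s≤s⁻¹ (≰⇒> ¬p))) ⟩
    700 * (7 * 7 ^ a)          ≡⟨ sevens (7 ^ a) ⟩
    100 * (49 * 7 ^ a)         ≤⟨ *-monoʳ-≤ 100 (*-monoˡ-≤ (7 ^ a) {49} {188} (m≤m+n 49 139)) ⟩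
    100 * (188 * 7 ^ a)        ≡⟨ swap 100 188 (7 ^ a) ⟩
    188 * (100 * 7 ^ a)        ≤⟨ *-monoʳ-≤ 188 (*-monoˡ-≤ (7 ^ a) (proj₁ (knot-range k∈))) ⟩
    188 * (from k * 7 ^ a)     ∎))

  split : ∀ s → 7 ^ (2 + a + s) ≡ 7 ^ a * (49 * 7 ^ s)
  split s = trans (^-distribˡ-+-* 7 (2 + a) s) (regroup (7 ^ a) (7 ^ s))
    where
    regroup : ∀ x y → 7 * (7 * x) * y ≡ x * (49 * y)
    regroup = solve-∀

  split₄ : ∀ s → 4 ^ (2 + a + s) ≡ 4 ^ a * (16 * 4 ^ s)
  split₄ s = trans (^-distribˡ-+-* 4 (2 + a) s) (regroup (4 ^ a) (4 ^ s))
    where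
    regroup : ∀ x y → 4 * (4 * x) * y ≡ x * (16 * y)
    regroup = solve-∀

  conclude : ∃[ s ] 2 + a + s ≡ b → upper l * (4 ^ b * 7 ^ a) < lower k * (4 ^ a * 7 ^ b)
  conclude (s , refl) = begin-strict
    upper l * (4 ^ (2 + a + s) * 7 ^ a)
      ≡⟨ cong (λ x → upper l * (x * 7 ^ a)) (split₄ s) ⟩
    upper l * (4 ^ a * (16 * 4 ^ s) * 7 ^ a)
      ≡⟨ left (upper l) (4 ^ a) (16 * 4 ^ s) (7 ^ a) ⟩
    4 ^ a * 7 ^ a * (upper l * (16 * 4 ^ s))
      <⟨ *-monoʳ-< (4 ^ a * 7 ^ a) {{m*n≢0 (4 ^ a) (7 ^ a) {{m^n≢0 4 a}} {{m^n≢0 7 a}}}}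
           {upper l * (16 * 4 ^ s)} {lower k * (49 * 7 ^ s)}
           (steeper {k} {l} (steep k∈ l∈) s (*-cancelˡ-< (7 ^ a) (188 * from k) (to l * (49 * 7 ^ s)) (begin-strict
             7 ^ a * (188 * from k)           ≡⟨ swap′ (7 ^ a) 188 (from k) ⟩
             188 * (from k * 7 ^ a)           <⟨ apart ⟩
             to l * 7 ^ (2 + a + s)           ≡⟨ cong (to l *_) (split s) ⟩
             to l * (7 ^ a * (49 * 7 ^ s))    ≡⟨ swap (to l) (7 ^ a) (49 * 7 ^ s) ⟩
             7 ^ a * (to l * (49 * 7 ^ s))    ∎))) ⟩
    4 ^ a * 7 ^ a * (lower k * (49 * 7 ^ s))
      ≡⟨ right (4 ^ a) (7 ^ a) (lower k) (49 * 7 ^ s) ⟩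
    lower k * (4 ^ a * (7 ^ a * (49 * 7 ^ s)))
      ≡⟨ cong (λ x → lower k * (4 ^ a * x)) (split s) ⟨
    lower k * (4 ^ a * 7 ^ (2 + a + s)) ∎
    where
    left : ∀ u x y z → u * (x * y * z) ≡ x * z * (u * y)
    left = solve-∀
    right : ∀ x y u z → x * y * (u * z) ≡ u * (x * (y * z))
    right = solve-∀
    swap′ : ∀ x y z → x * (y * z) ≡ y * (z * x)
    swap′ = solve-∀

last : ℕ → List Cut → ℕ
last s []               = s
last s (cut e _ _ ∷ cs) = last e cs

cover : ∀ s cs m x → s * m ≤ x → x < last s cs * m →
  ∃[ k ] k ∈ knotsFrom s cs × from k * m ≤ x × x < to k * m
cover s []               m x s≤ <e = contradiction s≤ (<⇒≱ <e)
cover s (cut e _ _ ∷ cs) m x s≤ <e with x <? e * m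
... | yes x<e = _ , here refl , s≤ , x<e
... | no  x≮e with k , k∈ , rest ← cover e cs m x (≮⇒≥ x≮e) <e = k , there k∈ , rest

scale : ∀ n g → 1 ≤ g → g < 7 ^ n → ∃[ a ] 7 ^ a ≤ g × g < 7 ^ suc a
scale zero    g 1≤g g< = contradiction 1≤g (<⇒≱ g<)
scale (suc n) g 1≤g g< with g <? 7 ^ n
... | yes g<′ = scale n g 1≤g g<′
... | no  g≮  = n , ≮⇒≥ g≮ , g<

find-knot : ∀ g → 1 ≤ g →
  ∃₂ λ a k → k ∈ knots × from k * 7 ^ a ≤ 100 * g × 100 * g < to k * 7 ^ a
find-knot g 1≤g =
  let a , ≤g , g< = scale g g 1≤g (n<7^n g)
      k , found = cover 100 cuts (7 ^ a) (100 * g) (*-monoʳ-≤ 100 ≤g)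
        (subst (100 * g <_) (sym (*-assoc 100 7 (7 ^ a))) (*-monoʳ-< 100 g<))
  in a , k , found

slopes-differ : ∀ {f g F D} → Bounded knots f g → Bounded knots F D →
  1 ≤ g → 188 * g ≤ D → D * f ≡ g * F → ⊥
slopes-differ {f} {g} {F} {D} near far 1≤g 188g≤D eq =
  conclude (find-knot g 1≤g) (find-knot D 1≤D)
  where
  open ≤-Reasoning
  1≤D : 1 ≤ D
  1≤D = ≤-trans 1≤g (≤-trans (m≤n*m g 188) 188g≤D)

  conclude : (∃₂ λ a k → k ∈ knots × from k * 7 ^ a ≤ 100 * g × 100 * g < to k * 7 ^ a) →
             (∃₂ λ b l → l ∈ knots × from l * 7 ^ b ≤ 100 * D × 100 * D < to l * 7 ^ b) → ⊥
  conclude (a , k , k∈ , k≤ , <k) (b , l , l∈ , l≤ , <l) = <-irrefl refl (begin-strict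
    lower k * (4 ^ a * 7 ^ b) * (g * D)
      ≡⟨ e₁ (lower k) (4 ^ a) (7 ^ b) g D ⟩
    7 ^ b * D * (lower k * (4 ^ a * g))
      ≤⟨ *-monoʳ-≤ (7 ^ b * D) (proj₁ (near a k∈ k≤ <k)) ⟩
    7 ^ b * D * (100 * (7 ^ a * f))
      ≡⟨ e₂ (7 ^ a) (7 ^ b) D f ⟩
    100 * (7 ^ a * 7 ^ b) * (D * f)
      ≡⟨ cong (100 * (7 ^ a * 7 ^ b) *_) eq ⟩
    100 * (7 ^ a * 7 ^ b) * (g * F)
      ≡⟨ e₃ (7 ^ a) (7 ^ b) g F ⟩
    7 ^ a * g * (100 * (7 ^ b * F))
      ≤⟨ *-monoʳ-≤ (7 ^ a * g) (proj₂ (far b l∈ l≤ <l)) ⟩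
    7 ^ a * g * (upper l * (4 ^ b * D))
      ≡⟨ e₄ (7 ^ a) g (upper l) (4 ^ b) D ⟩
    upper l * (4 ^ b * 7 ^ a) * (g * D)
      <⟨ *-monoˡ-< (g * D) {{m*n≢0 g D {{>-nonZero 1≤g}} {{>-nonZero 1≤D}}}}
           (slope-drops {k} {l} {a} {b} {g} {D} k∈ l∈ k≤ <l 188g≤D) ⟩
    lower k * (4 ^ a * 7 ^ b) * (g * D) ∎)
    where
    e₁ : ∀ s x y g d → s * (x * y) * (g * d) ≡ y * d * (s * (x * g))
    e₁ = solve-∀
    e₂ : ∀ x y d f → y * d * (100 * (x * f)) ≡ 100 * (x * y) * (d * f)
    e₂ = solve-∀
    e₃ : ∀ x y g f → 100 * (x * y) * (g * f) ≡ x * g * (100 * (y * f))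
    e₃ = solve-∀
    e₄ : ∀ x g t y d → x * g * (t * (y * d)) ≡ t * (y * x) * (g * d)
    e₄ = solve-∀

dev-cong : ∀ {a b c d} → a + d ≡ b + c → dev a b ≡ dev c d
dev-cong {a} {b} {c} {d} eq = cong₂ (λ x y → 3 * x ⊔′ 4 * y)
  (∸-cong {a} {b} eq)
  (∸-cong {b} {a} (sym eq))
  where
  ∸-cong : ∀ {a b c d} → a + d ≡ b + c → a ∸ b ≡ c ∸ d
  ∸-cong {a} {b} {c} {d} eq = ≤-antisym (∸-≤-∸ {a} {b} (≤-reflexive eq))
    (∸-≤-∸ {c} {d} (≤-reflexive (trans (+-comm c b) (trans (sym eq) (+-comm a d)))))

*-dev : ∀ k a b → k * dev a b ≡ dev (k * a) (k * b)
*-dev k a b = trans (*-distribˡ-⊔′ k (3 * (a ∸ b)) (4 * (b ∸ a)))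
  (cong₂ _⊔′_ (part 3 a b) (part 4 b a))
  where
  swap : ∀ k n x → k * (n * x) ≡ n * (k * x)
  swap = solve-∀
  part : ∀ n a b → k * (n * (a ∸ b)) ≡ n * (k * a ∸ k * b)
  part n a b = trans (swap k n (a ∸ b)) (cong (n *_) (*-distribˡ-∸ k a b))

-- Positive homogeneity of the gauge: the hypothesis is k (u - v) = l (x - y).
*-φ-cong : ∀ k l {u v x y : Step → ℕ} → (∀ c → k * u c + l * y c ≡ k * v c + l * x c) →
  k * φ u v ≡ l * φ x y
*-φ-cong k l {u} {v} {x} {y} eq = begin
  k * φ u v                                 ≡⟨ *-distribˡ-max k (λ c → dev (u c) (v c)) ⟩
  max (λ c → k * dev (u c) (v c))           ≡⟨ max-cong (λ c → trans (*-dev k (u c) (v c))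
                                                 (trans (dev-cong {k * u c} {k * v c} {l * x c} {l * y c} (eq c)) (sym (*-dev l (x c) (y c))))) ⟩
  max (λ c → l * dev (x c) (y c))           ≡⟨ *-distribˡ-max l (λ c → dev (x c) (y c)) ⟨
  l * φ x y                                 ∎
  where open ≡-Reasoning

-- Coordinates of the walk and proportional displacements

index : Step → Fin 3
index 𝐢 = 0F
index 𝐣 = 1F
index 𝐤 = 2F

lookup-⟦⟧ : ∀ s c → lookup ⟦ s ⟧ (index c) ≡ ℤ.+ match s c
lookup-⟦⟧ 𝐢 𝐢 = refl
lookup-⟦⟧ 𝐢 𝐣 = refl
lookup-⟦⟧ 𝐢 𝐤 = refl
lookup-⟦⟧ 𝐣 𝐢 = refl
lookup-⟦⟧ 𝐣 𝐣 = refl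
lookup-⟦⟧ 𝐣 𝐤 = refl
lookup-⟦⟧ 𝐤 𝐢 = refl
lookup-⟦⟧ 𝐤 𝐣 = refl
lookup-⟦⟧ 𝐤 𝐤 = refl

lookup-0 : ∀ c → lookup 0ℤ³ (index c) ≡ ℤ.+ 0
lookup-0 𝐢 = refl
lookup-0 𝐣 = refl
lookup-0 𝐤 = refl

visits-suc : ∀ p c → visits (suc p) c ≡ visits p c + match (v p) c
visits-suc p c = begin
  occ c (applyUpTo v (suc p))                   ≡⟨ cong (occ c) (applyUpTo-∷ʳ v p) ⟨
  occ c (applyUpTo v p ++ [ v p ])              ≡⟨ occ-++ c (applyUpTo v p) [ v p ] ⟩
  visits p c + (match (v p) c + 0)              ≡⟨ cong (visits p c +_) (+-identityʳ _) ⟩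
  visits p c + match (v p) c                    ∎
  where open ≡-Reasoning

lookup-z : ∀ p c → lookup (z p) (index c) ≡ ℤ.+ visits p c
lookup-z zero    c = lookup-0 c
lookup-z (suc p) c = begin
  lookup (z p +³ ⟦ v p ⟧) (index c)                       ≡⟨ lookup-zipWith ℤ._+_ (index c) (z p) ⟦ v p ⟧ ⟩
  lookup (z p) (index c) ℤ.+ lookup ⟦ v p ⟧ (index c)     ≡⟨ cong₂ ℤ._+_ (lookup-z p c) (lookup-⟦⟧ (v p) c) ⟩
  ℤ.+ visits p c ℤ.+ ℤ.+ match (v p) c                        ≡⟨ cong ℤ.+_ (visits-suc p c) ⟨
  ℤ.+ visits (suc p) c                                    ∎
  where open ≡-Reasoning

match-sum : ∀ s → match s 𝐢 + match s 𝐣 + match s 𝐤 ≡ 1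
match-sum 𝐢 = refl
match-sum 𝐣 = refl
match-sum 𝐤 = refl

visits-sum : ∀ p → visits p 𝐢 + visits p 𝐣 + visits p 𝐤 ≡ p
visits-sum zero    = refl
visits-sum (suc p) = begin
  visits (suc p) 𝐢 + visits (suc p) 𝐣 + visits (suc p) 𝐤
    ≡⟨ cong₂ _+_ (cong₂ _+_ (visits-suc p 𝐢) (visits-suc p 𝐣)) (visits-suc p 𝐤) ⟩
  visits p 𝐢 + match (v p) 𝐢 + (visits p 𝐣 + match (v p) 𝐣) + (visits p 𝐤 + match (v p) 𝐤)
    ≡⟨ regroup (visits p 𝐢) (visits p 𝐣) (visits p 𝐤) (match (v p) 𝐢) (match (v p) 𝐣) (match (v p) 𝐤) ⟩
  visits p 𝐢 + visits p 𝐣 + visits p 𝐤 + (match (v p) 𝐢 + match (v p) 𝐣 + match (v p) 𝐤)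
    ≡⟨ cong₂ _+_ (visits-sum p) (match-sum (v p)) ⟩
  p + 1                                   ≡⟨ +-comm p 1 ⟩
  suc p                                   ∎
  where
  open ≡-Reasoning
  regroup : ∀ x y w a b c → x + a + (y + b) + (w + c) ≡ x + y + w + (a + b + c)
  regroup = solve-∀

module _ (L : Line) {p g a d : ℕ} (p∈ : ι (z p) ∈ℓ L) (q∈ : ι (z (p + g)) ∈ℓ L)
         (a∈ : ι (z a) ∈ℓ L) (b∈ : ι (z (a + d)) ∈ℓ L) where

  private
    q = p + g
    b = a + d

    x : ℕ → Step → ℤ
    x n c = ℤ.+ visits n c

    cross : ∀ c e → (x q c ℤ.- x p c) ℤ.* (x b e ℤ.- x a e) ≡ (x b c ℤ.- x a c) ℤ.* (x q e ℤ.- x p e)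
    cross c e = subst₂ _≡_
      (cong₂ ℤ._*_ (diff q p c) (diff b a e)) (cong₂ ℤ._*_ (diff b a c) (diff q p e))
      (collinear L {z q} {z p} {z b} {z a} q∈ p∈ b∈ a∈ (index c) (index e))
      where
      diff : ∀ m n c → lookup (z m) (index c) ℤ.- lookup (z n) (index c) ≡ x m c ℤ.- x n c
      diff m n c = cong₂ ℤ._-_ (lookup-z m c) (lookup-z n c)

    x-sum : ∀ n → x n 𝐢 ℤ.+ x n 𝐣 ℤ.+ x n 𝐤 ≡ ℤ.+ n
    x-sum n = cong ℤ.+_ (visits-sum n)

    distribute : ∀ k m n → k ℤ.* (ℤ.+ m ℤ.- ℤ.+ n) ≡
      k ℤ.* (x m 𝐢 ℤ.- x n 𝐢) ℤ.+ k ℤ.* (x m 𝐣 ℤ.- x n 𝐣) ℤ.+ k ℤ.* (x m 𝐤 ℤ.- x n 𝐤)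
    distribute k m n = trans (cong₂ (λ s t → k ℤ.* (s ℤ.- t)) (sym (x-sum m)) (sym (x-sum n)))
      (identity k (x m 𝐢) (x m 𝐣) (x m 𝐤) (x n 𝐢) (x n 𝐣) (x n 𝐤))
      where
      identity : ∀ k a b c d e f → k ℤ.* ((a ℤ.+ b ℤ.+ c) ℤ.- (d ℤ.+ e ℤ.+ f)) ≡
        k ℤ.* (a ℤ.- d) ℤ.+ k ℤ.* (b ℤ.- e) ℤ.+ k ℤ.* (c ℤ.- f)
      identity = ℤ-Solver.solve-∀

    -- Summing `cross` over its second coordinate turns that coordinate into the number of steps, so
    -- the ratio of the two displacements is the ratio of their durations.
    summed : ∀ c → (x q c ℤ.- x p c) ℤ.* (ℤ.+ b ℤ.- ℤ.+ a) ≡ (x b c ℤ.- x a c) ℤ.* (ℤ.+ q ℤ.- ℤ.+ p)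
    summed c = trans (distribute (x q c ℤ.- x p c) b a)
      (trans (cong₂ ℤ._+_ (cong₂ ℤ._+_ (cross c 𝐢) (cross c 𝐣)) (cross c 𝐤))
        (sym (distribute (x b c ℤ.- x a c) q p)))

    visits-proportional : ∀ c → visits q c * d + visits a c * g ≡ visits p c * d + visits b c * g
    visits-proportional c = ℤ.+-injective (begin
      ℤ.+ (visits q c * d + visits a c * g)
        ≡⟨ products (visits q c) d (visits a c) g ⟩
      x q c ℤ.* D ℤ.+ x a c ℤ.* G
        ≡⟨ left (x q c) (x p c) (x a c) (ℤ.+ a) D G ⟩
      (x q c ℤ.- x p c) ℤ.* (ℤ.+ b ℤ.- ℤ.+ a) ℤ.+ (x p c ℤ.* D ℤ.+ x a c ℤ.* G)
        ≡⟨ cong (ℤ._+ (x p c ℤ.* D ℤ.+ x a c ℤ.* G)) (summed c) ⟩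
      (x b c ℤ.- x a c) ℤ.* (ℤ.+ q ℤ.- ℤ.+ p) ℤ.+ (x p c ℤ.* D ℤ.+ x a c ℤ.* G)
        ≡⟨ right (x b c) (x a c) (x p c) (ℤ.+ p) D G ⟩
      x p c ℤ.* D ℤ.+ x b c ℤ.* G
        ≡⟨ products (visits p c) d (visits b c) g ⟨
      ℤ.+ (visits p c * d + visits b c * g) ∎)
      where
      open ≡-Reasoning
      D = ℤ.+ d
      G = ℤ.+ g
      products : ∀ k l m n → ℤ.+ (k * l + m * n) ≡ ℤ.+ k ℤ.* ℤ.+ l ℤ.+ ℤ.+ m ℤ.* ℤ.+ n
      products k l m n = cong₂ ℤ._+_ (ℤ.pos-* k l) (ℤ.pos-* m n)
      left : ∀ xq xp xa a D G → xq ℤ.* D ℤ.+ xa ℤ.* G ≡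
        (xq ℤ.- xp) ℤ.* ((a ℤ.+ D) ℤ.- a) ℤ.+ (xp ℤ.* D ℤ.+ xa ℤ.* G)
      left = ℤ-Solver.solve-∀
      right : ∀ xb xa xp p D G → (xb ℤ.- xa) ℤ.* ((p ℤ.+ G) ℤ.- p) ℤ.+ (xp ℤ.* D ℤ.+ xa ℤ.* G) ≡
        xp ℤ.* D ℤ.+ xb ℤ.* G
      right = ℤ-Solver.solve-∀

  φ-proportional : d * φ (ahead p q) (behind p q) ≡ g * φ (ahead a b) (behind a b)
  φ-proportional = *-φ-cong d g λ c → begin
    d * (3 * visits q c + p) + g * (3 * visits a c + (a + d))
      ≡⟨ left d g p a (visits q c) (visits a c) ⟩
    3 * (visits q c * d + visits a c * g) + (d * p + g * (a + d))
      ≡⟨ cong (λ y → 3 * y + (d * p + g * (a + d))) (visits-proportional c) ⟩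
    3 * (visits p c * d + visits b c * g) + (d * p + g * (a + d))
      ≡⟨ right d g p a (visits p c) (visits b c) ⟩
    d * (3 * visits p c + (p + g)) + g * (3 * visits b c + a) ∎
    where
    open ≡-Reasoning
    left : ∀ d g p a y w → d * (3 * y + p) + g * (3 * w + (a + d)) ≡ 3 * (y * d + w * g) + (d * p + g * (a + d))
    left = solve-∀
    right : ∀ d g p a y w → 3 * (y * d + w * g) + (d * p + g * (a + d)) ≡ d * (3 * y + (p + g)) + g * (3 * w + a)
    right = solve-∀

no-close-pair : ∀ (L : Line) {p q a b} → p < q → a ≤ b → 188 * (q ∸ p) ≤ b ∸ a →
  ι (z p) ∈ℓ L → ι (z q) ∈ℓ L → ι (z a) ∈ℓ L → ι (z b) ∈ℓ L → ⊥
no-close-pair L {p} {q} {a} {b} p<q a≤b close p∈ q∈ a∈ b∈ =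
  slopes-differ {φ (ahead p q) (behind p q)} {q ∸ p} {φ (ahead a b) (behind a b)} {b ∸ a}
    (walk-bounded p<q) (walk-bounded a<b) 0<g close
    (subst₂ (λ q′ b′ → (b ∸ a) * φ (ahead p q′) (behind p q′) ≡ (q ∸ p) * φ (ahead a b′) (behind a b′)) q≡ b≡
      (φ-proportional L {p} {q ∸ p} {a} {b ∸ a} p∈ (subst (λ n → ι (z n) ∈ℓ L) (sym q≡) q∈) a∈ (subst (λ n → ι (z n) ∈ℓ L) (sym b≡) b∈)))
  where
  0<g : 0 < q ∸ p
  0<g = m<n⇒0<n∸m p<q
  q≡ : p + (q ∸ p) ≡ q
  q≡ = m+[n∸m]≡n (<⇒≤ p<q)
  b≡ : a + (b ∸ a) ≡ b
  b≡ = m+[n∸m]≡n a≤b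
  a<b : a < b
  a<b = m∸n≢0⇒n<m (m<n⇒n≢0 (≤-trans 0<g (≤-trans (m≤n*m (q ∸ p) 188) close)))

-- Two points close in time

same-quotient : ∀ {x y} n .{{_ : NonZero n}} → x / n ≡ y / n → y ∸ x < n
same-quotient {x} {y} n eq = m<n+o⇒m∸n<o y x (begin-strict
  y                     ≡⟨ m≡m%n+[m/n]*n y n ⟩
  y % n + y / n * n     <⟨ +-monoˡ-< (y / n * n) (m%n<n y n) ⟩
  n + y / n * n         ≡⟨ cong (λ k → n + k * n) eq ⟨
  n + x / n * n         ≤⟨ +-monoʳ-≤ n (m/n*n≤m x n) ⟩
  n + x                 ≡⟨ +-comm n x ⟩
  x + n                 ∎)
  where open ≤-Reasoning

extrema : ∀ {n} (p : Fin (suc n) → ℕ) → ∃₂ λ a b → (∀ i → p a ≤ p i) × (∀ i → p i ≤ p b)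
extrema {n} p = argmin p 0F (allFin (suc n)) , argmax p 0F (allFin (suc n)) ,
  (λ i → All.lookup (f[argmin]≤f[xs] {f = p} 0F (allFin (suc n))) (∈-allFin i)) ,
  (λ i → All.lookup (f[xs]≤f[argmax] {f = p} 0F (allFin (suc n))) (∈-allFin i))

module _ {n} .{{_ : NonZero n}} {p : Fin (suc n) → ℕ} (injective : Injective _≡_ _≡_ p)
         {a b} (a≤ : ∀ i → p a ≤ p i) (≤b : ∀ i → p i ≤ p b) where

  private
    diameter width : ℕ
    diameter = p b ∸ p a
    -- The successor makes `n` buckets reach strictly beyond the diameter, so the last point has a
    -- bucket too; yet integers in one bucket differ by at most `diameter / n`.
    width    = suc (diameter / n)

    diameter< : diameter < n * width
    diameter< = begin-strict
      diameter                           ≡⟨ m≡m%n+[m/n]*n diameter n ⟩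
      diameter % n + diameter / n * n    <⟨ +-monoˡ-< (diameter / n * n) (m%n<n diameter n) ⟩
      n + diameter / n * n               ≡⟨ *-comm width n ⟩
      n * width                          ∎
      where open ≤-Reasoning

    bucket< : ∀ i → (p i ∸ p a) / width < n
    bucket< i = m<n*o⇒m/o<n (≤-<-trans (∸-monoˡ-≤ (p a) (≤b i)) diameter<)

    bucket : Fin (suc n) → Fin n
    bucket i = fromℕ< (bucket< i)

    quotient≡ : ∀ i j → bucket i ≡ bucket j → (p i ∸ p a) / width ≡ (p j ∸ p a) / width
    quotient≡ i j same = trans (sym (Fin.toℕ-fromℕ< (bucket< i)))
      (trans (cong toℕ same) (Fin.toℕ-fromℕ< (bucket< j)))

    difference : ∀ i j → (p j ∸ p a) ∸ (p i ∸ p a) ≡ p j ∸ p i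
    difference i j = trans (∸-+-assoc (p j) (p a) (p i ∸ p a)) (cong (p j ∸_) (m+[n∸m]≡n (a≤ i)))

    close : ∀ i j → bucket i ≡ bucket j → n * (p j ∸ p i) ≤ diameter
    close i j same = begin
      n * (p j ∸ p i)                       ≡⟨ cong (n *_) (difference i j) ⟨
      n * ((p j ∸ p a) ∸ (p i ∸ p a))       ≤⟨ *-monoʳ-≤ n (s≤s⁻¹ (same-quotient {p i ∸ p a} {p j ∸ p a} width (quotient≡ i j same))) ⟩
      n * (diameter / n)                    ≡⟨ *-comm n (diameter / n) ⟩
      diameter / n * n                      ≤⟨ m/n*n≤m diameter n ⟩
      diameter                              ∎
      where open ≤-Reasoning

  -- Pigeonhole: cut the range of p into n intervals of equal length.
  close-pair : ∃₂ λ i j → p i < p j × n * (p j ∸ p i) ≤ p b ∸ p a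
  close-pair = conclude (Fin.pigeonhole (n<1+n n) bucket)
    where
    separate : ∀ i j → toℕ i < toℕ j → bucket i ≡ bucket j →
      Tri (p i < p j) (p i ≡ p j) (p j < p i) → ∃₂ λ i j → p i < p j × n * (p j ∸ p i) ≤ p b ∸ p a
    separate i j i<j same (tri< pᵢ<pⱼ _ _) = i , j , pᵢ<pⱼ , close i j same
    separate i j i<j same (tri> _ _ pⱼ<pᵢ) = j , i , pⱼ<pᵢ , close j i (sym same)
    separate i j i<j same (tri≈ _ pᵢ≡pⱼ _) =
      contradiction i<j (<-irrefl (cong toℕ (injective pᵢ≡pⱼ)))

    conclude : (∃₂ λ i j → toℕ i < toℕ j × bucket i ≡ bucket j) →
      ∃₂ λ i j → p i < p j × n * (p j ∸ p i) ≤ p b ∸ p a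
    conclude (i , j , i<j , same) = separate i j i<j same (<-cmp (p i) (p j))

theorem1 : (L : Line) →
    ¬ (Σ[ p ∈ (Fin 189 → ℕ) ] (Injective _≡_ _≡_ (λ i → point W (p i)) × (∀ i → ι (point W (p i)) ∈ℓ L)))
theorem1 L (p , injective , p∈) =
  let a , b , a≤ , ≤b = extrema p
      i , j , pᵢ<pⱼ , close = close-pair (λ eq → injective (cong z eq)) a≤ ≤b
  in no-close-pair L pᵢ<pⱼ (a≤ b) close (p∈ i) (p∈ j) (p∈ a) (p∈ b)
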